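{- Fix $p \in (0,1)$ (a constant independent of $n$). The following property holds asymptotically almost surely for $G = (V,E) \in \mathcal{G}(n,p)$: $$ \mathrm{pq}(G) \le \mathrm{eq}(G) \le k := \frac {3}{p^2 (1-p)^2} \log n = O \left( \log n \right). $$
   Context: Query game on a simple graph $G=(V,E)$: $d_G(u,v)$ denotes the graph distance. An adversary fixes a target vertex $v^*\in V$ unknown to an adaptive algorithm. In each round the algorithm queries two vertices $u,v$, and the adversary replies with whichever of $u,v$ is closer to $v^*$ (with either one, at the adversary's choice, if $d_G(u,v^*)=d_G(v,v^*)$). Equivalently: put $V_0=V$; in round $t$ the algorithm presents $(u_t,v_t)$ (depending on $G$ and earlier replies) and the adversary chooses either $V_t=\{x\in V_{t-1}: d_G(u_t,x)\le d_G(v_t,x)\}$ (reply $u_t$) or $V_t=\{x\in V_{t-1}: d_G(v_t,x)\le d_G(u_t,x)\}$ (reply $v_t$); the target is located once $|V_t|=1$. A pair query allows arbitrary $u,v\in V$; an edge query requires $u$ and $v$ to be adjacent. $\mathrm{pq}(G)$ (respectively $\mathrm{eq}(G)$) is the least integer $t$ such that the algorithm can locate the target in at most $t$ pair queries (respectively edge queries), regardless of the strategy of the adversary. $\mathcal{G}(n,p)$ is the binomial random graph on vertex set $\{1,\dots,n\}$, each pair being an edge independently with probability $p$. A property holds asymptotically almost surely (a.a.s.) if its probability tends to $1$ as $n\to\infty$. $\log$ is the natural logarithm. Expressions that have to be integers (such as $k$) are rounded up or down without specifying which. -}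

module Defs where

open import Data.Bool using (Bool; true; false; T; if_then_else_)
open import Data.Bool.Properties using (T?)
open import Data.Fin using (Fin; zero; suc)
open import Data.Fin.Properties using (any?) renaming (_≟_ to _≟ᶠ_)
open import Data.Fin.Subset using (Subset; Nonempty; _∩_; ⊤) renaming (∣_∣ to size)
open import Data.Fin.Subset.Properties using (nonempty?)
import Data.Integer as ℤ
import Data.Integer.Properties as ℤₚ
open import Data.List using (List; []; _∷_; map; foldr; filter; cartesianProductWith)
open import Data.Nat as ℕ using (ℕ; zero; suc)
import Data.Nat.Properties as ℕₚ
open import Data.Product using (∃; ∃₂; _×_; _,_; proj₁; proj₂)
open import Data.Rational as ℚ using (ℚ; 0ℚ; 1ℚ)
import Data.Rational.Properties as ℚₚ
open import Data.Rational.Solver using (module +-*-Solver)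
open import Data.Sum using (inj₁; inj₂)
import Data.Unit as Unit
open import Data.Vec as Vec using (Vec; []; _∷_; lookup; tabulate)
open import Function using (_∘_)
open import Relation.Binary using (Rel; Decidable)
import Relation.Binary.Construct.Add.Supremum.NonStrict as Supremum
open import Relation.Binary.PropositionalEquality
  using (_≡_; refl; sym; trans; cong; cong₂; subst; subst₂)
open import Relation.Nullary using (Dec; yes; no; does; contradiction)
open import Relation.Nullary.Construct.Add.Supremum using (_⁺; ⊤⁺; [_])
open import Relation.Nullary.Decidable using (map′; _×-dec_; _→-dec_)
import Relation.Unary as U
open import Level using (0ℓ)

------------------------------------------------------------------------
-- Real numbers as Cauchy sequences of rationals.  Unqualified arithmetic
-- and order symbols below refer to ℝ.

Eventually : (ℕ → Set) → Set
Eventually P = ∃ λ N → ∀ n → N ℕ.≤ n → P n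

IsCauchy : (ℕ → ℚ) → Set
IsCauchy x = ∀ ε → 0ℚ ℚ.< ε →
  ∃ λ N → ∀ m n → N ℕ.≤ m → N ℕ.≤ n → ℚ.∣ x m ℚ.- x n ∣ ℚ.≤ ε

record ℝ : Set where
  constructor mkℝ
  field
    seq    : ℕ → ℚ
    cauchy : IsCauchy seq

open ℝ public

infix 4 _<_ _≤_

_≤_ : ℝ → ℝ → Set
x ≤ y = ∀ ε → 0ℚ ℚ.< ε → Eventually λ n → seq x n ℚ.≤ seq y n ℚ.+ ε

_<_ : ℝ → ℝ → Set
x < y = ∃ λ ε → 0ℚ ℚ.< ε × Eventually λ n → seq x n ℚ.+ ε ℚ.≤ seq y n

∣∣-swap : ∀ a b → ℚ.∣ a ℚ.- b ∣ ≡ ℚ.∣ b ℚ.- a ∣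
∣∣-swap a b = trans (cong ℚ.∣_∣ (eq a b)) (ℚₚ.∣-p∣≡∣p∣ (b ℚ.- a))
  where
  open +-*-Solver
  eq : ∀ a b → a ℚ.- b ≡ ℚ.- (b ℚ.- a)
  eq = solve 2 (λ a b → a :- b := :- (b :- a)) refl

≤-shift : ∀ {a b c} → a ℚ.- b ℚ.≤ c → a ℚ.≤ c ℚ.+ b
≤-shift {a} {b} p = subst (ℚ._≤ _) (eq a b) (ℚₚ.+-monoˡ-≤ b p)
  where
  open +-*-Solver
  eq : ∀ a b → (a ℚ.- b) ℚ.+ b ≡ a
  eq = solve 2 (λ a b → (a :- b) :+ b := a) refl

≤-unshift : ∀ {a b c} → a ℚ.≤ c ℚ.+ b → a ℚ.- b ℚ.≤ c
≤-unshift {a} {b} {c} p = subst (_ ℚ.≤_) (eq c b) (ℚₚ.+-monoˡ-≤ (ℚ.- b) p)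
  where
  open +-*-Solver
  eq : ∀ a b → (a ℚ.+ b) ℚ.- b ≡ a
  eq = solve 2 (λ a b → (a :+ b) :- b := a) refl

∣a∣≤∣a-b∣+∣b∣ : ∀ a b → ℚ.∣ a ∣ ℚ.≤ ℚ.∣ a ℚ.- b ∣ ℚ.+ ℚ.∣ b ∣
∣a∣≤∣a-b∣+∣b∣ a b =
  subst (λ c → ℚ.∣ c ∣ ℚ.≤ ℚ.∣ a ℚ.- b ∣ ℚ.+ ℚ.∣ b ∣) (eq a b) (ℚₚ.∣p+q∣≤∣p∣+∣q∣ (a ℚ.- b) b)
  where
  open +-*-Solver
  eq : ∀ a b → (a ℚ.- b) ℚ.+ b ≡ a
  eq = solve 2 (λ a b → (a :- b) :+ b := a) refl

∣a-b∣≤ : ∀ {a b c} → a ℚ.- b ℚ.≤ c → b ℚ.- a ℚ.≤ c → ℚ.∣ a ℚ.- b ∣ ℚ.≤ c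
∣a-b∣≤ {a} {b} p q with ℚₚ.∣p∣≡p∨∣p∣≡-p (a ℚ.- b)
... | inj₁ e = subst (ℚ._≤ _) (sym e) p
... | inj₂ e = subst (ℚ._≤ _) (sym (trans e (eq a b))) q
  where
  open +-*-Solver
  eq : ∀ a b → ℚ.- (a ℚ.- b) ≡ b ℚ.- a
  eq = solve 2 (λ a b → :- (a :- b) := b :- a) refl

⊔-l : ∀ {m n k} → m ℕ.⊔ n ℕ.≤ k → m ℕ.≤ k
⊔-l = ℕₚ.m⊔n≤o⇒m≤o _ _
⊔-r : ∀ {m n k} → m ℕ.⊔ n ℕ.≤ k → n ℕ.≤ k
⊔-r = ℕₚ.m⊔n≤o⇒n≤o _ _

*-pos : ∀ {a b} → 0ℚ ℚ.< a → 0ℚ ℚ.< b → 0ℚ ℚ.< a ℚ.* b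
*-pos {a} {b} p q =
  ℚₚ.positive⁻¹ _ {{ℚₚ.pos*pos⇒pos a {{ℚ.positive p}} b {{ℚ.positive q}}}}

*-mono : ∀ {a b c d} → 0ℚ ℚ.≤ b → 0ℚ ℚ.≤ c → a ℚ.≤ b → c ℚ.≤ d →
         a ℚ.* c ℚ.≤ b ℚ.* d
*-mono {a} {b} {c} {d} 0≤b 0≤c p q = ℚₚ.≤-trans
  (ℚₚ.*-monoʳ-≤-nonNeg c {{ℚ.nonNegative 0≤c}} p)
  (ℚₚ.*-monoˡ-≤-nonNeg b {{ℚ.nonNegative 0≤b}} q)

inv : ∀ a → 0ℚ ℚ.< a → ℚ
inv a 0<a = (ℚ.1/ a) {{ℚ.>-nonZero 0<a}}

inv-pos : ∀ a (0<a : 0ℚ ℚ.< a) → 0ℚ ℚ.< inv a 0<a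
inv-pos a 0<a = ℚₚ.positive⁻¹ _ {{ℚₚ.1/pos⇒pos a {{ℚ.positive 0<a}}}}

inv-r : ∀ a (0<a : 0ℚ ℚ.< a) → a ℚ.* inv a 0<a ≡ 1ℚ
inv-r a 0<a = ℚₚ.*-inverseʳ a {{ℚ.>-nonZero 0<a}}

inv-anti : ∀ {a b} (0<a : 0ℚ ℚ.< a) (0<b : 0ℚ ℚ.< b) → a ℚ.≤ b →
           inv b 0<b ℚ.≤ inv a 0<a
inv-anti {a} {b} 0<a 0<b a≤b = subst₂ ℚ._≤_ eq₁ eq₂
  (ℚₚ.*-monoʳ-≤-nonNeg (ia ℚ.* ib)
    {{ℚ.nonNegative (ℚₚ.<⇒≤ (*-pos (inv-pos a 0<a) (inv-pos b 0<b)))}} a≤b)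
  where
  ia = inv a 0<a
  ib = inv b 0<b
  eq₁ : a ℚ.* (ia ℚ.* ib) ≡ ib
  eq₁ = trans (sym (ℚₚ.*-assoc a ia ib))
          (trans (cong (ℚ._* ib) (inv-r a 0<a)) (ℚₚ.*-identityˡ ib))
  eq₂ : b ℚ.* (ia ℚ.* ib) ≡ ia
  eq₂ = trans (cong (b ℚ.*_) (ℚₚ.*-comm ia ib))
          (trans (sym (ℚₚ.*-assoc b ib ia))
            (trans (cong (ℚ._* ia) (inv-r b 0<b)) (ℚₚ.*-identityˡ ia)))

½>0 : 0ℚ ℚ.< ℚ.½
½>0 = ℚₚ.positive⁻¹ ℚ.½

half+half : ∀ ε → ℚ.½ ℚ.* ε ℚ.+ ℚ.½ ℚ.* ε ≡ ε
half+half ε = trans (sym (ℚₚ.*-distribʳ-+ ε ℚ.½ ℚ.½)) (ℚₚ.*-identityˡ ε)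

fromℚ : ℚ → ℝ
seq    (fromℚ a) _ = a
cauchy (fromℚ a) ε 0<ε = 0 , λ _ _ _ _ →
  subst (ℚ._≤ ε) (sym (cong ℚ.∣_∣ (ℚₚ.+-inverseʳ a))) (ℚₚ.<⇒≤ 0<ε)

fromℕ : ℕ → ℝ
fromℕ n = fromℚ (ℤ.+ n ℚ./ 1)

0ℝ 1ℝ : ℝ
0ℝ = fromℕ 0
1ℝ = fromℕ 1

infixl 6 _+_ _-_
infixl 7 _*_
infix  8 -_

_+_ : ℝ → ℝ → ℝ
seq    (x + y) n = seq x n ℚ.+ seq y n
cauchy (x + y) ε 0<ε
  with cauchy x (ℚ.½ ℚ.* ε) (*-pos ½>0 0<ε) | cauchy y (ℚ.½ ℚ.* ε) (*-pos ½>0 0<ε)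
... | N , hx | M , hy = N ℕ.⊔ M , λ m n p q → ℚₚ.≤-trans
  (subst (ℚ._≤ ℚ.∣ seq x m ℚ.- seq x n ∣ ℚ.+ ℚ.∣ seq y m ℚ.- seq y n ∣)
    (cong ℚ.∣_∣ (eq (seq x m) (seq x n) (seq y m) (seq y n)))
    (ℚₚ.∣p+q∣≤∣p∣+∣q∣ (seq x m ℚ.- seq x n) (seq y m ℚ.- seq y n)))
  (ℚₚ.≤-trans (ℚₚ.+-mono-≤ (hx m n (⊔-l p) (⊔-l q)) (hy m n (⊔-r p) (⊔-r q)))
    (ℚₚ.≤-reflexive (half+half ε)))
  where
  open +-*-Solver
  eq : ∀ a b c d → (a ℚ.- b) ℚ.+ (c ℚ.- d) ≡ (a ℚ.+ c) ℚ.- (b ℚ.+ d)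
  eq = solve 4 (λ a b c d → (a :- b) :+ (c :- d) := (a :+ c) :- (b :+ d)) refl

-_ : ℝ → ℝ
seq    (- x) n = ℚ.- seq x n
cauchy (- x) ε 0<ε with cauchy x ε 0<ε
... | N , h = N , λ m n p q →
  subst (ℚ._≤ ε) (cong ℚ.∣_∣ (eq (seq x n) (seq x m))) (h n m q p)
  where
  open +-*-Solver
  eq : ∀ a b → a ℚ.- b ≡ ℚ.- b ℚ.- ℚ.- a
  eq = solve 2 (λ a b → a :- b := :- b :- :- a) refl

_-_ : ℝ → ℝ → ℝ
x - y = x + - y

∣_∣ : ℝ → ℝ
seq    ∣ x ∣ n = ℚ.∣ seq x n ∣
cauchy ∣ x ∣ ε 0<ε with cauchy x ε 0<ε
... | N , h = N , λ m n p q → ℚₚ.≤-trans (reverse (seq x m) (seq x n)) (h m n p q)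
  where
  reverse : ∀ a b → ℚ.∣ ℚ.∣ a ∣ ℚ.- ℚ.∣ b ∣ ∣ ℚ.≤ ℚ.∣ a ℚ.- b ∣
  reverse a b = ∣a-b∣≤ {ℚ.∣ a ∣} {ℚ.∣ b ∣}
    (≤-unshift (∣a∣≤∣a-b∣+∣b∣ a b))
    (≤-unshift (subst (λ c → _ ℚ.≤ c ℚ.+ _) (∣∣-swap b a) (∣a∣≤∣a-b∣+∣b∣ b a)))

bounded : ∀ x → ∃ λ B → 0ℚ ℚ.< B × Eventually λ n → ℚ.∣ seq x n ∣ ℚ.≤ B
bounded x with cauchy x 1ℚ (ℚₚ.positive⁻¹ 1ℚ)
... | N , h = 1ℚ ℚ.+ ℚ.∣ seq x N ∣
    , ℚₚ.+-mono-<-≤ (ℚₚ.positive⁻¹ 1ℚ) (ℚₚ.0≤∣p∣ (seq x N))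
    , N , λ n p → ℚₚ.≤-trans (∣a∣≤∣a-b∣+∣b∣ (seq x n) (seq x N))
                    (ℚₚ.+-monoˡ-≤ _ (h n N p ℕₚ.≤-refl))

*-close : ∀ a b c d {B C δ} → 0ℚ ℚ.< B → 0ℚ ℚ.< C →
          ℚ.∣ a ∣ ℚ.≤ B → ℚ.∣ d ∣ ℚ.≤ C →
          ℚ.∣ a ℚ.- b ∣ ℚ.≤ δ → ℚ.∣ c ℚ.- d ∣ ℚ.≤ δ →
          ℚ.∣ a ℚ.* c ℚ.- b ℚ.* d ∣ ℚ.≤ (B ℚ.+ C) ℚ.* δ
*-close a b c d {B} {C} {δ} 0<B 0<C a≤B d≤C a-b≤δ c-d≤δ = begin
  ℚ.∣ a ℚ.* c ℚ.- b ℚ.* d ∣                          ≡⟨ cong ℚ.∣_∣ (split a b c d) ⟩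
  ℚ.∣ a ℚ.* (c ℚ.- d) ℚ.+ d ℚ.* (a ℚ.- b) ∣
    ≤⟨ ℚₚ.∣p+q∣≤∣p∣+∣q∣ (a ℚ.* (c ℚ.- d)) (d ℚ.* (a ℚ.- b)) ⟩
  ℚ.∣ a ℚ.* (c ℚ.- d) ∣ ℚ.+ ℚ.∣ d ℚ.* (a ℚ.- b) ∣
    ≤⟨ ℚₚ.+-mono-≤ (prod a (c ℚ.- d) 0<B a≤B c-d≤δ) (prod d (a ℚ.- b) 0<C d≤C a-b≤δ) ⟩
  B ℚ.* δ ℚ.+ C ℚ.* δ                                ≡⟨ ℚₚ.*-distribʳ-+ δ B C ⟨
  (B ℚ.+ C) ℚ.* δ                                    ∎
  where
  open ℚₚ.≤-Reasoning
  open +-*-Solver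
  split : ∀ a b c d → a ℚ.* c ℚ.- b ℚ.* d ≡ a ℚ.* (c ℚ.- d) ℚ.+ d ℚ.* (a ℚ.- b)
  split = solve 4 (λ a b c d → a :* c :- b :* d := a :* (c :- d) :+ d :* (a :- b)) refl
  prod : ∀ a b {D} → 0ℚ ℚ.< D → ℚ.∣ a ∣ ℚ.≤ D → ℚ.∣ b ∣ ℚ.≤ δ →
         ℚ.∣ a ℚ.* b ∣ ℚ.≤ D ℚ.* δ
  prod a b 0<D p q = ℚₚ.≤-trans (ℚₚ.≤-reflexive (ℚₚ.∣p*q∣≡∣p∣*∣q∣ a b))
    (*-mono (ℚₚ.<⇒≤ 0<D) (ℚₚ.0≤∣p∣ b) p q)

*-cauchy : ∀ {x y} → IsCauchy x → IsCauchy y →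
           (∃ λ B → 0ℚ ℚ.< B × Eventually λ n → ℚ.∣ x n ∣ ℚ.≤ B) →
           (∃ λ C → 0ℚ ℚ.< C × Eventually λ n → ℚ.∣ y n ∣ ℚ.≤ C) →
           IsCauchy (λ n → x n ℚ.* y n)
*-cauchy {x} {y} cx cy (B , 0<B , N₁ , hB) (C , 0<C , N₂ , hC) ε 0<ε =
  combine (cx δ 0<δ) (cy δ 0<δ)
  where
  0<B+C : 0ℚ ℚ.< B ℚ.+ C
  0<B+C = ℚₚ.+-mono-< 0<B 0<C
  δ : ℚ
  δ = inv (B ℚ.+ C) 0<B+C ℚ.* ε
  0<δ : 0ℚ ℚ.< δ
  0<δ = *-pos (inv-pos (B ℚ.+ C) 0<B+C) 0<ε
  total : (B ℚ.+ C) ℚ.* δ ≡ ε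
  total = trans (sym (ℚₚ.*-assoc (B ℚ.+ C) (inv (B ℚ.+ C) 0<B+C) ε))
            (trans (cong (ℚ._* ε) (inv-r (B ℚ.+ C) 0<B+C)) (ℚₚ.*-identityˡ ε))
  combine : (∃ λ N → ∀ m n → N ℕ.≤ m → N ℕ.≤ n → ℚ.∣ x m ℚ.- x n ∣ ℚ.≤ δ) →
            (∃ λ N → ∀ m n → N ℕ.≤ m → N ℕ.≤ n → ℚ.∣ y m ℚ.- y n ∣ ℚ.≤ δ) →
            ∃ λ N → ∀ m n → N ℕ.≤ m → N ℕ.≤ n →
              ℚ.∣ x m ℚ.* y m ℚ.- x n ℚ.* y n ∣ ℚ.≤ ε
  combine (Nx , hx) (Ny , hy) = (N₁ ℕ.⊔ N₂) ℕ.⊔ (Nx ℕ.⊔ Ny) , λ m n p q →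
    subst (ℚ.∣ x m ℚ.* y m ℚ.- x n ℚ.* y n ∣ ℚ.≤_) total
      (*-close (x m) (x n) (y m) (y n) 0<B 0<C (hB m (n₁ p)) (hC n (n₂ q))
        (hx m n (nx p) (nx q)) (hy m n (ny p) (ny q)))
    where
    n₁ : ∀ {k} → (N₁ ℕ.⊔ N₂) ℕ.⊔ (Nx ℕ.⊔ Ny) ℕ.≤ k → N₁ ℕ.≤ k
    n₁ p = ⊔-l {N₁} {N₂} (⊔-l {N₁ ℕ.⊔ N₂} {Nx ℕ.⊔ Ny} p)
    n₂ : ∀ {k} → (N₁ ℕ.⊔ N₂) ℕ.⊔ (Nx ℕ.⊔ Ny) ℕ.≤ k → N₂ ℕ.≤ k
    n₂ p = ⊔-r {N₁} {N₂} (⊔-l {N₁ ℕ.⊔ N₂} {Nx ℕ.⊔ Ny} p)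
    nx : ∀ {k} → (N₁ ℕ.⊔ N₂) ℕ.⊔ (Nx ℕ.⊔ Ny) ℕ.≤ k → Nx ℕ.≤ k
    nx p = ⊔-l {Nx} {Ny} (⊔-r {N₁ ℕ.⊔ N₂} {Nx ℕ.⊔ Ny} p)
    ny : ∀ {k} → (N₁ ℕ.⊔ N₂) ℕ.⊔ (Nx ℕ.⊔ Ny) ℕ.≤ k → Ny ℕ.≤ k
    ny p = ⊔-r {Nx} {Ny} (⊔-r {N₁ ℕ.⊔ N₂} {Nx ℕ.⊔ Ny} p)

_*_ : ℝ → ℝ → ℝ
seq    (x * y) n = seq x n ℚ.* seq y n
cauchy (x * y) = *-cauchy (cauchy x) (cauchy y) (bounded x) (bounded y)

-- The n-th term is clamped from below by the witness of positivity, so that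
-- it can be inverted for every n; the clamp is eventually inactive.
recip : (x : ℝ) → 0ℝ < x → ℝ
recip x (e , 0<e , N₀ , h) = mkℝ (λ n → inv (seq x n ℚ.⊔ e) (clamped n)) isCauchy
  where
  clamped : ∀ n → 0ℚ ℚ.< seq x n ℚ.⊔ e
  clamped n = ℚₚ.<-≤-trans 0<e (ℚₚ.p≤q⊔p (seq x n) e)
  e≤x : ∀ n → N₀ ℕ.≤ n → e ℚ.≤ seq x n
  e≤x n p = subst (ℚ._≤ _) (ℚₚ.+-identityˡ e) (h n p)
  inactive : ∀ n → N₀ ℕ.≤ n → seq x n ℚ.⊔ e ≡ seq x n
  inactive n p = ℚₚ.p≥q⇒p⊔q≡p (e≤x n p)
  ie = inv e 0<e
  open +-*-Solver
  inv-diff : ∀ a b (0<a : 0ℚ ℚ.< a) (0<b : 0ℚ ℚ.< b) →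
             inv a 0<a ℚ.- inv b 0<b ≡ (b ℚ.- a) ℚ.* (inv a 0<a ℚ.* inv b 0<b)
  inv-diff a b 0<a 0<b = sym (trans (expand a b ia ib)
    (trans (cong₂ ℚ._-_ (cong (ia ℚ.*_) (inv-r b 0<b)) (cong (ib ℚ.*_) (inv-r a 0<a)))
      (cong₂ ℚ._-_ (ℚₚ.*-identityʳ ia) (ℚₚ.*-identityʳ ib))))
    where
    ia = inv a 0<a
    ib = inv b 0<b
    expand : ∀ a b c d → (b ℚ.- a) ℚ.* (c ℚ.* d) ≡ c ℚ.* (b ℚ.* d) ℚ.- d ℚ.* (a ℚ.* c)
    expand = solve 4 (λ a b c d →
      (b :- a) :* (c :* d) := c :* (b :* d) :- d :* (a :* c)) refl
  inv-lip : ∀ a b δ (0<a : 0ℚ ℚ.< a) (0<b : 0ℚ ℚ.< b) → e ℚ.≤ a → e ℚ.≤ b →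
            ℚ.∣ b ℚ.- a ∣ ℚ.≤ δ →
            ℚ.∣ inv a 0<a ℚ.- inv b 0<b ∣ ℚ.≤ δ ℚ.* (ie ℚ.* ie)
  inv-lip a b δ 0<a 0<b p q r = ℚₚ.≤-trans
    (ℚₚ.≤-reflexive (trans (cong ℚ.∣_∣ (inv-diff a b 0<a 0<b))
      (trans (ℚₚ.∣p*q∣≡∣p∣*∣q∣ (b ℚ.- a) _)
        (cong (ℚ.∣ b ℚ.- a ∣ ℚ.*_) (ℚₚ.0≤p⇒∣p∣≡p (ℚₚ.<⇒≤ 0<iaib))))))
    (*-mono (ℚₚ.≤-trans (ℚₚ.0≤∣p∣ _) r) (ℚₚ.<⇒≤ 0<iaib) r
      (*-mono (ℚₚ.<⇒≤ (inv-pos e 0<e)) (ℚₚ.<⇒≤ (inv-pos b 0<b))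
        (inv-anti 0<e 0<a p) (inv-anti 0<e 0<b q)))
    where
    0<iaib : 0ℚ ℚ.< inv a 0<a ℚ.* inv b 0<b
    0<iaib = *-pos (inv-pos a 0<a) (inv-pos b 0<b)
  isCauchy : IsCauchy (λ n → inv (seq x n ℚ.⊔ e) (clamped n))
  isCauchy ε 0<ε = N₀ ℕ.⊔ N , λ m n p q → ℚₚ.≤-trans
    (inv-lip _ _ δ (clamped m) (clamped n)
      (ℚₚ.p≤q⊔p (seq x m) e) (ℚₚ.p≤q⊔p (seq x n) e)
      (subst₂ (λ a b → ℚ.∣ a ℚ.- b ∣ ℚ.≤ δ)
        (sym (inactive n (⊔-l q))) (sym (inactive m (⊔-l p)))
        (close n m (⊔-r {N₀} q) (⊔-r {N₀} p))))
    (ℚₚ.≤-reflexive total)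
    where
    δ = ε ℚ.* (e ℚ.* e)
    0<δ : 0ℚ ℚ.< δ
    0<δ = *-pos 0<ε (*-pos 0<e 0<e)
    N = proj₁ (cauchy x δ 0<δ)
    close = proj₂ (cauchy x δ 0<δ)
    total : δ ℚ.* (ie ℚ.* ie) ≡ ε
    total = trans (regroup ε e ie)
      (trans (cong (ε ℚ.*_) (cong₂ ℚ._*_ (inv-r e 0<e) (inv-r e 0<e))) (ℚₚ.*-identityʳ ε))
      where
      regroup : ∀ a b c → (a ℚ.* (b ℚ.* b)) ℚ.* (c ℚ.* c) ≡ a ℚ.* ((b ℚ.* c) ℚ.* (b ℚ.* c))
      regroup = solve 3 (λ a b c →
        (a :* (b :* b)) :* (c :* c) := a :* ((b :* c) :* (b :* c))) refl

0<x*y : ∀ {x y} → 0ℝ < x → 0ℝ < y → 0ℝ < x * y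
0<x*y {x} {y} (d , 0<d , N , h) (e , 0<e , M , k) =
  d ℚ.* e , *-pos 0<d 0<e , N ℕ.⊔ M , λ n p →
    subst (ℚ._≤ _) (sym (ℚₚ.+-identityˡ (d ℚ.* e)))
      (*-mono (ℚₚ.≤-trans (ℚₚ.<⇒≤ 0<d) (d≤x n (⊔-l p))) (ℚₚ.<⇒≤ 0<e)
        (d≤x n (⊔-l p)) (subst (ℚ._≤ _) (ℚₚ.+-identityˡ e) (k n (⊔-r p))))
  where
  d≤x : ∀ n → N ℕ.≤ n → d ℚ.≤ seq x n
  d≤x n p = subst (ℚ._≤ _) (ℚₚ.+-identityˡ d) (h n p)

x<y⇒0<y-x : ∀ {x y} → x < y → 0ℝ < y - x
x<y⇒0<y-x {x} {y} (e , 0<e , N , h) = e , 0<e , N , λ n p →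
  subst₂ ℚ._≤_ (eq (seq x n) e) refl (ℚₚ.+-monoˡ-≤ (ℚ.- seq x n) (h n p))
  where
  open +-*-Solver
  eq : ∀ a b → (a ℚ.+ b) ℚ.- a ≡ 0ℚ ℚ.+ b
  eq = solve 2 (λ a b → (a :+ b) :- a := con 0ℚ :+ b) refl

------------------------------------------------------------------------
-- Natural logarithm of a natural number, as ∫₁ⁿ dx/x.

-- 1/(a+1) + ⋯ + 1/(a+l)
reciprocals : ℕ → ℕ → ℚ
reciprocals a zero    = 0ℚ
reciprocals a (suc l) = ℤ.+ 1 ℚ./ suc a ℚ.+ reciprocals (suc a) l

-- The right-endpoint Riemann sum of ∫₁ⁿ dx/x with mesh 1/M is
-- Σ_{M<i≤nM} (1/M)(M/i) = 1/(M+1) + ⋯ + 1/(nM).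
-- Here n = suc r and M = suc m.
riemann : ℕ → ℕ → ℚ
riemann r m = reciprocals (suc m) (r ℕ.* suc m)

1/suc : ℕ → ℚ
1/suc a = ℤ.+ 1 ℚ./ suc a

1/suc-pos : ∀ a → 0ℚ ℚ.< 1/suc a
1/suc-pos a = ℚₚ.positive⁻¹ _ {{ℚₚ.normalize-pos 1 (suc a)}}

frac-mono : ∀ a b c d → a ℕ.* suc d ℕ.≤ c ℕ.* suc b →
            ℤ.+ a ℚ./ suc b ℚ.≤ ℤ.+ c ℚ./ suc d
frac-mono a b c d p = ℚₚ.toℚᵘ-cancel-≤
  (ℚᵘₚ.≤-respˡ-≃ (ℚᵘₚ.≃-sym (ℚₚ.toℚᵘ-fromℚᵘ (mkℚᵘ (ℤ.+ a) b)))
    (ℚᵘₚ.≤-respʳ-≃ (ℚᵘₚ.≃-sym (ℚₚ.toℚᵘ-fromℚᵘ (mkℚᵘ (ℤ.+ c) d)))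
      (*≤* (subst₂ ℤ._≤_ (ℤₚ.pos-* a (suc d)) (ℤₚ.pos-* c (suc b)) (ℤ.+≤+ p)))))
  where
  import Data.Rational.Unnormalised.Properties as ℚᵘₚ
  open import Data.Rational.Unnormalised using (mkℚᵘ; *≤*)

frac-suc : ∀ a d → ℤ.+ 1 ℚ./ suc d ℚ.+ ℤ.+ a ℚ./ suc d ≡ ℤ.+ suc a ℚ./ suc d
frac-suc a d = ℚₚ.toℚᵘ-injective
  (ℚᵘₚ.≃-trans (ℚₚ.toℚᵘ-homo-+ (ℤ.+ 1 ℚ./ suc d) (ℤ.+ a ℚ./ suc d))
    (ℚᵘₚ.≃-trans
      (ℚᵘₚ.+-cong (ℚₚ.toℚᵘ-fromℚᵘ (mkℚᵘ (ℤ.+ 1) d)) (ℚₚ.toℚᵘ-fromℚᵘ (mkℚᵘ (ℤ.+ a) d)))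
      (ℚᵘₚ.≃-trans (*≡* (eq (ℤ.+ a) (ℤ.+ suc d)))
        (ℚᵘₚ.≃-sym (ℚₚ.toℚᵘ-fromℚᵘ (mkℚᵘ (ℤ.+ suc a) d))))))
  where
  import Data.Rational.Unnormalised.Properties as ℚᵘₚ
  open import Data.Rational.Unnormalised using (mkℚᵘ; *≡*)
  open import Data.Integer.Solver using () renaming (module +-*-Solver to ℤ-Solver)
  open ℤ-Solver
  eq : ∀ a d → (ℤ.+ 1 ℤ.* d ℤ.+ a ℤ.* d) ℤ.* d ≡ (ℤ.+ 1 ℤ.+ a) ℤ.* (d ℤ.* d)
  eq = solve 2 (λ a d →
    (con (ℤ.+ 1) :* d :+ a :* d) :* d := (con (ℤ.+ 1) :+ a) :* (d :* d)) refl

reciprocals-+ : ∀ a k l →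
  reciprocals a (k ℕ.+ l) ≡ reciprocals a k ℚ.+ reciprocals (a ℕ.+ k) l
reciprocals-+ a zero l = trans (cong (λ b → reciprocals b l) (sym (ℕₚ.+-identityʳ a)))
                               (sym (ℚₚ.+-identityˡ _))
reciprocals-+ a (suc k) l = trans (cong (1/suc a ℚ.+_) (reciprocals-+ (suc a) k l))
  (trans (sym (ℚₚ.+-assoc (1/suc a) _ _))
    (cong (λ b → (1/suc a ℚ.+ reciprocals (suc a) k) ℚ.+ reciprocals b l)
      (sym (ℕₚ.+-suc a k))))

block-lower : ∀ a l d → a ℕ.+ l ℕ.≤ suc d → ℤ.+ l ℚ./ suc d ℚ.≤ reciprocals a l
block-lower a zero    d p = frac-mono 0 d 0 0 ℕ.z≤n
block-lower a (suc l) d p = subst (ℚ._≤ _) (frac-suc l d) (ℚₚ.+-mono-≤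
  (frac-mono 1 d 1 a (ℕₚ.*-monoʳ-≤ 1 (ℕₚ.≤-trans
    (ℕₚ.≤-trans (ℕ.s≤s (ℕₚ.m≤m+n a l)) (ℕₚ.≤-reflexive (sym (ℕₚ.+-suc a l)))) p)))
  (block-lower (suc a) l d (subst (ℕ._≤ suc d) (ℕₚ.+-suc a l) p)))

block-upper : ∀ a l d → suc d ℕ.≤ suc a → reciprocals a l ℚ.≤ ℤ.+ l ℚ./ suc d
block-upper a zero    d p = frac-mono 0 0 0 d ℕ.z≤n
block-upper a (suc l) d p = subst (_ ℚ.≤_) (frac-suc l d) (ℚₚ.+-mono-≤
  (frac-mono 1 a 1 d (ℕₚ.*-monoʳ-≤ 1 p))
  (block-upper (suc a) l d (ℕₚ.m≤n⇒m≤1+n p)))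

-- refining the mesh by a factor K = suc k
refine-lower : ∀ a l k → reciprocals a l ℚ.≤ reciprocals (a ℕ.* suc k) (l ℕ.* suc k)
refine-lower a zero    k = ℚₚ.≤-refl
refine-lower a (suc l) k = subst (_ ℚ.≤_)
  (sym (reciprocals-+ (a ℕ.* suc k) (suc k) (l ℕ.* suc k)))
  (ℚₚ.+-mono-≤
    (ℚₚ.≤-trans
      (frac-mono 1 a (suc k) (k ℕ.+ a ℕ.* suc k)
        (ℕₚ.≤-reflexive (trans (ℕₚ.*-identityˡ _) (ℕₚ.*-comm (suc a) (suc k)))))
      (block-lower (a ℕ.* suc k) (suc k) (k ℕ.+ a ℕ.* suc k)
        (ℕₚ.≤-reflexive (ℕₚ.+-comm (a ℕ.* suc k) (suc k)))))
    (subst (λ b → reciprocals (suc a) l ℚ.≤ reciprocals b (l ℕ.* suc k))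
      (ℕₚ.+-comm (suc k) (a ℕ.* suc k)) (refine-lower (suc a) l k)))

refine-upper : ∀ a l k →
  reciprocals (suc a ℕ.* suc k) (l ℕ.* suc k) ℚ.≤ reciprocals a l
refine-upper a zero    k = ℚₚ.≤-refl
refine-upper a (suc l) k = subst (ℚ._≤ _)
  (sym (reciprocals-+ (suc a ℕ.* suc k) (suc k) (l ℕ.* suc k)))
  (ℚₚ.+-mono-≤
    (ℚₚ.≤-trans
      (block-upper (suc a ℕ.* suc k) (suc k) (k ℕ.+ a ℕ.* suc k) (ℕₚ.n≤1+n _))
      (frac-mono (suc k) (k ℕ.+ a ℕ.* suc k) 1 a
        (ℕₚ.≤-reflexive (trans (ℕₚ.*-comm (suc k) (suc a)) (sym (ℕₚ.*-identityˡ _))))))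
    (subst (λ b → reciprocals b (l ℕ.* suc k) ℚ.≤ reciprocals (suc a) l)
      (ℕₚ.+-comm (suc k) (suc a ℕ.* suc k)) (refine-upper (suc a) l k)))

reciprocals-shift : ∀ a l → reciprocals a l ℚ.≤ 1/suc a ℚ.+ reciprocals (suc a) l
reciprocals-shift a l = subst₂ ℚ._≤_ (ℚₚ.+-identityʳ _)
  (trans (sym (reciprocals-+ a l 1)) (cong (reciprocals a) (ℕₚ.+-comm l 1)))
  (ℚₚ.+-monoʳ-≤ (reciprocals a l)
    (subst (0ℚ ℚ.≤_) (sym (ℚₚ.+-identityʳ (1/suc (a ℕ.+ l))))
      (ℚₚ.<⇒≤ (1/suc-pos (a ℕ.+ l)))))

riemann-close : ∀ r m n → riemann r m ℚ.- riemann r n ℚ.≤ 1/suc n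
riemann-close r m n = ≤-unshift (ℚₚ.≤-trans
  (subst (riemann r m ℚ.≤_) common (refine-lower (suc m) (r ℕ.* suc m) n))
  (ℚₚ.≤-trans (refine-upper n (r ℕ.* suc n) m) (reciprocals-shift n (r ℕ.* suc n))))
  where
  common : reciprocals (suc m ℕ.* suc n) (r ℕ.* suc m ℕ.* suc n)
         ≡ reciprocals (suc n ℕ.* suc m) (r ℕ.* suc n ℕ.* suc m)
  common = cong₂ reciprocals (ℕₚ.*-comm (suc m) (suc n))
    (trans (ℕₚ.*-assoc r (suc m) (suc n))
      (trans (cong (r ℕ.*_) (ℕₚ.*-comm (suc m) (suc n)))
        (sym (ℕₚ.*-assoc r (suc n) (suc m)))))

archimedean : ∀ ε → 0ℚ ℚ.< ε → ∃ λ N → 1/suc N ℚ.≤ ε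
archimedean ε@(ℚ.mkℚ (ℤ.+ zero) d c) 0<ε =
  contradiction (ℚ.positive 0<ε) λ ()
archimedean ε@(ℚ.mkℚ (ℤ.+ suc a) d c) 0<ε = d ,
  subst (1/suc d ℚ.≤_) (ℚₚ.↥p/↧p≡p ε)
    (frac-mono 1 d (suc a) d (ℕₚ.*-monoˡ-≤ (suc d) (ℕ.s≤s (ℕ.z≤n {a}))))
archimedean ε@(ℚ.mkℚ ℤ.-[1+ a ] d c) 0<ε =
  contradiction (ℚ.positive 0<ε) λ ()

riemann-cauchy : ∀ r → IsCauchy (riemann r)
riemann-cauchy r ε 0<ε with archimedean ε 0<ε
... | N , h = N , λ m n p q → ∣a-b∣≤ {riemann r m} {riemann r n}
  (ℚₚ.≤-trans (riemann-close r m n) (ℚₚ.≤-trans (small q) h))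
  (ℚₚ.≤-trans (riemann-close r n m) (ℚₚ.≤-trans (small p) h))
  where
  small : ∀ {k} → N ℕ.≤ k → 1/suc k ℚ.≤ 1/suc N
  small {k} p = frac-mono 1 k 1 N (ℕₚ.*-monoʳ-≤ 1 (ℕ.s≤s p))

-- The value at 0 is a convention; log is only used asymptotically.
log : ℕ → ℝ
log zero    = 0ℝ
log (suc r) = mkℝ (riemann r) (riemann-cauchy r)

------------------------------------------------------------------------
-- Asymptotics

TendsTo : (ℕ → ℝ) → ℝ → Set
TendsTo a ℓ = ∀ ε → 0ℝ < ε → Eventually λ n → ∣ a n - ℓ ∣ < ε

_∈O_ : (ℕ → ℝ) → (ℕ → ℝ) → Set
f ∈O g = ∃ λ C → Eventually λ n → ∣ f n ∣ ≤ C * ∣ g n ∣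

-- The integers at distance less than 1 from x are exactly ⌊x⌋ and ⌈x⌉.
_IsRoundingOf_ : ℕ → ℝ → Set
t IsRoundingOf x = ∣ fromℕ t - x ∣ < 1ℝ

------------------------------------------------------------------------
-- Graphs and distance

record SimpleGraph (n : ℕ) : Set where
  field
    adj    : Fin n → Fin n → Bool
    symm   : ∀ u v → adj u v ≡ adj v u
    irrefl : ∀ u → adj u u ≡ false

  Adjacent : Rel (Fin n) 0ℓ
  Adjacent u v = T (adj u v)

  data Walk : ℕ → Fin n → Fin n → Set where
    here : ∀ {u} → Walk 0 u u
    step : ∀ {l u w v} → Adjacent u w → Walk l w v → Walk (suc l) u v

  walk? : ∀ l u v → Dec (Walk l u v)
  walk? zero    u v = map′ (λ { refl → here }) (λ { here → refl }) (u ≟ᶠ v)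
  walk? (suc l) u v = map′ (λ { (_ , a , w) → step a w }) (λ { (step a w) → _ , a , w })
    (any? λ w → T? (adj u w) ×-dec walk? l w v)

  shortest : Fin n → Fin n → (start fuel : ℕ) → ℕ ⁺
  shortest u v l zero       = ⊤⁺
  shortest u v l (suc fuel) =
    if does (walk? l u v) then [ l ] else shortest u v (suc l) fuel

  -- The least length of a walk from u to v, and ⊤⁺ (infinity) if there is
  -- none.  A shortest walk is a path, so lengths below n suffice.
  dist : Fin n → Fin n → ℕ ⁺
  dist u v = shortest u v 0 n

open SimpleGraph public

open Supremum ℕ._≤_ public using (_≤⁺_; ≤⁺-dec)

------------------------------------------------------------------------
-- The query game

closer : ∀ {n} → SimpleGraph n → Fin n → Fin n → Subset n
closer G u v = tabulate λ x → does (≤⁺-dec ℕ._≤?_ (dist G u x) (dist G v x))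

-- LocatesWithin G Allowed t S: with the target known to lie in S, the
-- algorithm can locate it in at most t queries of the allowed kind.  The
-- adversary has fixed a target, so only replies leaving a nonempty set of
-- candidates are possible.
data LocatesWithin {n} (G : SimpleGraph n) (Allowed : Rel (Fin n) 0ℓ)
                   : ℕ → Subset n → Set where
  located : ∀ {t S} → size S ≡ 1 → LocatesWithin G Allowed t S
  query   : ∀ {t S} u v → Allowed u v →
            (Nonempty (S ∩ closer G u v) → LocatesWithin G Allowed t (S ∩ closer G u v)) →
            (Nonempty (S ∩ closer G v u) → LocatesWithin G Allowed t (S ∩ closer G v u)) →
            LocatesWithin G Allowed (suc t) S

locatesWithin? : ∀ {n} (G : SimpleGraph n) {Allowed : Rel (Fin n) 0ℓ} →
                 Decidable Allowed → Decidable (LocatesWithin G Allowed)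
locatesWithin? G A? t S with size S ℕ.≟ 1
locatesWithin? G A? t       S | yes p = yes (located p)
locatesWithin? G A? zero    S | no ¬p = no λ { (located p) → ¬p p }
locatesWithin? G A? (suc t) S | no ¬p = map′
  (λ { (u , v , a , f , g) → query u v a f g })
  (λ { (located p) → contradiction p ¬p ; (query u v a f g) → u , v , a , f , g })
  (any? λ u → any? λ v → A? u v
    ×-dec (nonempty? _ →-dec locatesWithin? G A? t (S ∩ closer G u v))
    ×-dec (nonempty? _ →-dec locatesWithin? G A? t (S ∩ closer G v u)))

IsLeast : (ℕ → Set) → ℕ → Set
IsLeast P a = P a × (∀ b → P b → a ℕ.≤ b)

isLeast? : ∀ {P : ℕ → Set} → U.Decidable P → U.Decidable (IsLeast P)
isLeast? P? a = P? a ×-dec map′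
  (λ none b Pb → ℕₚ.≮⇒≥ λ b<a → none (b , b<a , Pb))
  (λ { least (b , b<a , Pb) → ℕₚ.<⇒≱ b<a (least b Pb) })
  (ℕₚ.anyUpTo? P? a →-dec no λ ())

PairQuery : ∀ {n} → Rel (Fin n) 0ℓ
PairQuery u v = Unit.⊤

-- pq G and eq G are given as relations, since they need not be finite for
-- every graph (eq G is infinite when G has at least two vertices and no edges).
_HasPq_ : ∀ {n} → SimpleGraph n → ℕ → Set
G HasPq a = IsLeast (λ t → LocatesWithin G PairQuery t ⊤) a

_HasEq_ : ∀ {n} → SimpleGraph n → ℕ → Set
G HasEq b = IsLeast (λ t → LocatesWithin G (Adjacent G) t ⊤) b

Pq≤Eq≤ : ∀ {n} → ℕ → SimpleGraph n → Set
Pq≤Eq≤ k G = ∃₂ λ a b → G HasPq a × G HasEq b × a ℕ.≤ b × b ℕ.≤ k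

pq≤eq≤? : ∀ {n} k → U.Decidable (Pq≤Eq≤ {n} k)
pq≤eq≤? k G = map′
  (λ { (b , b<1+k , eq , a , a<1+b , pq) → a , b , pq , eq , ℕₚ.≤-pred a<1+b , ℕₚ.≤-pred b<1+k })
  (λ { (a , b , pq , eq , a≤b , b≤k) → b , ℕ.s≤s b≤k , eq , a , ℕ.s≤s a≤b , pq })
  (ℕₚ.anyUpTo?
    (λ b → isLeast? (λ t → locatesWithin? G (λ u v → T? (adj G u v)) t ⊤) b
      ×-dec ℕₚ.anyUpTo?
        (isLeast? (λ t → locatesWithin? G (λ _ _ → yes Unit.tt) t ⊤)) (suc b))
    (suc k))

------------------------------------------------------------------------
-- The binomial random graph G(n,p), with vertex set Fin n

-- One coin for each pair of distinct vertices: the row of coins for the pairs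
-- {0,1}, …, {0,n}, followed by the coins for the pairs of nonzero vertices.
data Coins : ℕ → Set where
  []  : Coins 0
  _∷_ : ∀ {n} → Vec Bool n → Coins n → Coins (suc n)

coin : ∀ {n} → Coins n → Fin n → Fin n → Bool
coin (r ∷ c) zero    zero    = false
coin (r ∷ c) zero    (suc v) = lookup r v
coin (r ∷ c) (suc u) zero    = lookup r u
coin (r ∷ c) (suc u) (suc v) = coin c u v

graph : ∀ {n} → Coins n → SimpleGraph n
graph c = record { adj = coin c ; symm = coin-symm c ; irrefl = coin-irrefl c }
  where
  coin-symm : ∀ {n} (c : Coins n) u v → coin c u v ≡ coin c v u
  coin-symm (r ∷ c) zero    zero    = refl
  coin-symm (r ∷ c) zero    (suc v) = refl
  coin-symm (r ∷ c) (suc u) zero    = refl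
  coin-symm (r ∷ c) (suc u) (suc v) = coin-symm c u v
  coin-irrefl : ∀ {n} (c : Coins n) u → coin c u u ≡ false
  coin-irrefl (r ∷ c) zero    = refl
  coin-irrefl (r ∷ c) (suc u) = coin-irrefl c u

allRows : ∀ n → List (Vec Bool n)
allRows zero    = [] ∷ []
allRows (suc n) = cartesianProductWith _∷_ (true ∷ false ∷ []) (allRows n)

allCoins : ∀ n → List (Coins n)
allCoins zero    = [] ∷ []
allCoins (suc n) = cartesianProductWith _∷_ (allRows n) (allCoins n)

rowWeight : ∀ {n} → ℝ → Vec Bool n → ℝ
rowWeight p []      = 1ℝ
rowWeight p (b ∷ r) = (if b then p else 1ℝ - p) * rowWeight p r

weight : ∀ {n} → ℝ → Coins n → ℝ
weight p []      = 1ℝ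
weight p (r ∷ c) = rowWeight p r * weight p c

Pr : (p : ℝ) (n : ℕ) {E : SimpleGraph n → Set} → U.Decidable E → ℝ
Pr p n E? = foldr _+_ 0ℝ (map (weight p) (filter (E? ∘ graph) (allCoins n)))

AsymptoticallyAlmostSurely :
  (p : ℝ) {E : ∀ n → SimpleGraph n → Set} → (∀ n → U.Decidable (E n)) → Set
AsymptoticallyAlmostSurely p E? = TendsTo (λ n → Pr p n (E? n)) 1ℝ

------------------------------------------------------------------------

-- 3 / (p² (1 - p)²) · log n
bound : (p : ℝ) → 0ℝ < p → p < 1ℝ → ℕ → ℝ
bound p 0<p p<1 n = fromℕ 3 * recip ((p * p) * (q * q)) 0<p²q² * log n
  where
  q : ℝ
  q = 1ℝ - p
  0<q : 0ℝ < q
  0<q = x<y⇒0<y-x {p} {1ℝ} p<1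
  0<p²q² : 0ℝ < (p * p) * (q * q)
  0<p²q² = 0<x*y {p * p} {q * q} (0<x*y {p} {p} 0<p 0<p) (0<x*y {q} {q} 0<q 0<q)

module Submission where

-- Fix disjoint pairs of vertices (u₁,v₁), …, (u_M,v_M) before looking at the graph, and query
-- the first b of them that turn out to be edges.  If u is adjacent to x and v is not, then
-- d(u,x) = 1 < d(v,x), so the edge (u,v) separates x from y whenever u ~ x, v ≁ x, v ~ y, u ≁ y
-- or the reverse; given that uv is an edge, this has probability 2s with s = p²(1-p)².  Hence x
-- and y stay together with probability at most about (1-2s)^b, plus the probability that fewer
-- than b of the pairs are edges.  With 2^J ≤ n < 2^(J+1), the budget 3/s · log n allows
-- b = dJ - 1 for some d with (1-2s)^d ≤ 1/5, and M proportional to J makes the second term as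
-- small, so a union bound over the n² pairs (x,y) leaves O((4/5)^J).
-- Since p is a Cauchy sequence, all of this is carried out for its rational terms.

open import Defs
open import Algebra.Bundles using (CommutativeRing)
import Data.Rational.Properties as ℚₚ
open import Algebra.Properties.Semiring.Exp (CommutativeRing.semiring ℚₚ.+-*-commutativeRing)
  using (_^_; ^-homo-*; ^-assocʳ)
open import Data.Bool using (Bool; true; false; if_then_else_; not; _∧_; _∨_; T)
open import Data.Bool.Properties using (T?; ∧-zeroʳ; T-≡)
open import Data.Fin using (Fin; zero; suc)
open import Data.Fin.Properties using () renaming (_≟_ to _≟ᶠ_)
open import Data.Fin.Subset using (Subset; Nonempty; ⊤; ⁅_⁆; _∈_) renaming (∣_∣ to size)
open import Data.Fin.Subset.Properties
  using (⊆-antisym; x∈⁅y⁆⇒x≡y; x∈⁅x⁆; ∣⁅x⁆∣≡1; x∈p∩q⁻; ∈⊤)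
import Data.Integer as ℤ
open import Data.List
  using (List; []; _∷_; _++_; map; foldr; filter; cartesianProductWith; length; allFin)
open import Data.List.Properties using (map-∘; length-map; length-tabulate)
open import Data.List.Membership.Propositional.Properties using (∈-allFin)
open import Data.List.Relation.Unary.All as All using (All; []; _∷_)
import Data.List.Relation.Unary.All.Properties as Allₚ
open import Data.List.Relation.Unary.AllPairs as AllPairs using (AllPairs; []; _∷_)
import Data.List.Relation.Unary.AllPairs.Properties as AllPairsₚ
open import Data.Nat as ℕ using (ℕ; zero; suc)
open import Data.Nat.Induction using (<-rec)
import Data.Nat.Properties as ℕₚ
open import Data.Nat.Solver using () renaming (module +-*-Solver to ℕ-Solver)
open import Data.Product using (_×_; ∃; ∃₂; _,_; proj₁; proj₂)
open import Data.Rational as ℚ using (ℚ; 0ℚ; 1ℚ)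
open import Data.Rational.Solver using (module +-*-Solver)
open import Data.Sum using (_⊎_; inj₁; inj₂)
open import Data.Unit using (tt)
open import Data.Vec using (Vec; []; _∷_; _[_]≔_)
open import Data.Vec.Properties using (lookup∘update; lookup∘update′; []=⇒lookup; lookup∘tabulate)
open import Function using (_∘_; id; Equivalence)
open import Level using (0ℓ)
open import Relation.Binary using (Rel)
open import Relation.Binary.Construct.Add.Supremum.NonStrict ℕ._≤_ using ([_]; _≤⊤⁺; ≤⁺-trans)
open import Relation.Binary.PropositionalEquality
  using (_≡_; _≢_; refl; sym; trans; cong; cong₂; subst; subst₂; module ≡-Reasoning)
open import Relation.Nullary using (¬_; Dec; does; yes; no; contradiction)
open import Relation.Nullary.Construct.Add.Supremum using ([_])
open import Relation.Nullary.Decidable using (dec-false; dec-true; toWitness; isYes≗does)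
import Relation.Unary as U

-- Expectation over the coins

-- Independence is never stated. The pairs are disjoint, so the five coins joining u, v, x, y other
-- than xy are not read by the pairs that follow; redrawing them with everything else fixed gives an
-- exact recursion in the pairs and queries that remain (`confused-step`). A pair containing x or y
-- lacks five such coins, but a matching has at most two of these pairs, and each is charged a
-- factor 2. The constant 3 leaves room for crude bounds: log 2 ≥ 1/2 turns the budget into about
-- 3J/(2s) queries, and 5J/(4s) already suffice. The same slack lets one integer d serve all late
-- rational terms of p.

sumBy : {A : Set} → List A → (A → ℚ) → ℚ
sumBy xs g = foldr ℚ._+_ 0ℚ (map g xs)

sumBy-cong : {A : Set} (xs : List A) {g h : A → ℚ} → (∀ a → g a ≡ h a) → sumBy xs g ≡ sumBy xs h
sumBy-cong []       e = refl
sumBy-cong (x ∷ xs) e = cong₂ ℚ._+_ (e x) (sumBy-cong xs e)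

sumBy-*ˡ : {A : Set} (xs : List A) (a : ℚ) (g : A → ℚ) →
           sumBy xs (λ x → a ℚ.* g x) ≡ a ℚ.* sumBy xs g
sumBy-*ˡ []       a g = sym (ℚₚ.*-zeroʳ a)
sumBy-*ˡ (x ∷ xs) a g = trans (cong (a ℚ.* g x ℚ.+_) (sumBy-*ˡ xs a g))
                              (sym (ℚₚ.*-distribˡ-+ a (g x) (sumBy xs g)))

sumBy-++ : {A : Set} (xs ys : List A) (g : A → ℚ) →
           sumBy (xs ++ ys) g ≡ sumBy xs g ℚ.+ sumBy ys g
sumBy-++ []       ys g = sym (ℚₚ.+-identityˡ _)
sumBy-++ (x ∷ xs) ys g = trans (cong (g x ℚ.+_) (sumBy-++ xs ys g)) (sym (ℚₚ.+-assoc (g x) _ _))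

sumBy-cartesianProductWith : {A B C : Set} (f : A → B → C) (xs : List A) (ys : List B) (g : C → ℚ) →
  sumBy (cartesianProductWith f xs ys) g ≡ sumBy xs (λ x → sumBy ys (g ∘ f x))
sumBy-cartesianProductWith f []       ys g = refl
sumBy-cartesianProductWith f (x ∷ xs) ys g =
  trans (sumBy-++ (map (f x) ys) (cartesianProductWith f xs ys) g)
    (cong₂ ℚ._+_ (cong (foldr ℚ._+_ 0ℚ) (sym (map-∘ ys))) (sumBy-cartesianProductWith f xs ys g))

indicator : Bool → ℚ
indicator true  = 1ℚ
indicator false = 0ℚ

0≤indicator : ∀ b → 0ℚ ℚ.≤ indicator b
0≤indicator true  = ℚₚ.<⇒≤ (ℚₚ.positive⁻¹ 1ℚ)
0≤indicator false = ℚₚ.≤-refl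

indicator≤1 : ∀ b → indicator b ℚ.≤ 1ℚ
indicator≤1 true  = ℚₚ.≤-refl
indicator≤1 false = 0≤indicator true

module Expectation (p : ℚ) where

  q : ℚ
  q = 1ℚ ℚ.- p

  mix : ℚ → ℚ → ℚ
  mix a b = p ℚ.* a ℚ.+ q ℚ.* b

  mix-idem : ∀ a → mix a a ≡ a
  mix-idem a = solve 2 (λ p a → p :* a :+ (con 1ℚ :- p) :* a := a) refl p a
    where open +-*-Solver

  mix-linear : ∀ s t a b c d → mix (s ℚ.* a ℚ.+ t ℚ.* b) (s ℚ.* c ℚ.+ t ℚ.* d)
                             ≡ s ℚ.* mix a c ℚ.+ t ℚ.* mix b d
  mix-linear = solve 7 (λ p s t a b c d →
    p :* (s :* a :+ t :* b) :+ (con 1ℚ :- p) :* (s :* c :+ t :* d)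
      := s :* (p :* a :+ (con 1ℚ :- p) :* c) :+ t :* (p :* b :+ (con 1ℚ :- p) :* d)) refl p
    where open +-*-Solver

  𝔼row : ∀ n → (Vec Bool n → ℚ) → ℚ
  𝔼row zero    f = f []
  𝔼row (suc n) f = mix (𝔼row n (f ∘ (true ∷_))) (𝔼row n (f ∘ (false ∷_)))

  -- Iterated averaging instead of a weighted sum over `allCoins`: total mass one and the redrawing
  -- of a coin become identities about `mix`. `sum-coins` supplies the agreement with `Pr`.
  𝔼 : ∀ n → (Coins n → ℚ) → ℚ
  𝔼 zero    f = f []
  𝔼 (suc n) f = 𝔼row n (λ r → 𝔼 n (λ c → f (r ∷ c)))

  𝔼row-cong : ∀ n {f g : Vec Bool n → ℚ} → (∀ r → f r ≡ g r) → 𝔼row n f ≡ 𝔼row n g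
  𝔼row-cong zero    e = e []
  𝔼row-cong (suc n) e = cong₂ mix (𝔼row-cong n (e ∘ (true ∷_))) (𝔼row-cong n (e ∘ (false ∷_)))

  𝔼-cong : ∀ n {f g : Coins n → ℚ} → (∀ c → f c ≡ g c) → 𝔼 n f ≡ 𝔼 n g
  𝔼-cong zero    e = e []
  𝔼-cong (suc n) e = 𝔼row-cong n λ r → 𝔼-cong n λ c → e (r ∷ c)

  𝔼row-const : ∀ n a → 𝔼row n (λ _ → a) ≡ a
  𝔼row-const zero    a = refl
  𝔼row-const (suc n) a = trans (cong₂ mix (𝔼row-const n a) (𝔼row-const n a)) (mix-idem a)

  𝔼-const : ∀ n a → 𝔼 n (λ _ → a) ≡ a
  𝔼-const zero    a = refl
  𝔼-const (suc n) a = trans (𝔼row-cong n λ _ → 𝔼-const n a) (𝔼row-const n a)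

  𝔼row-linear : ∀ n s t (f g : Vec Bool n → ℚ) →
    𝔼row n (λ r → s ℚ.* f r ℚ.+ t ℚ.* g r) ≡ s ℚ.* 𝔼row n f ℚ.+ t ℚ.* 𝔼row n g
  𝔼row-linear zero    s t f g = refl
  𝔼row-linear (suc n) s t f g =
    trans (cong₂ mix (𝔼row-linear n s t (f ∘ (true ∷_)) (g ∘ (true ∷_)))
                     (𝔼row-linear n s t (f ∘ (false ∷_)) (g ∘ (false ∷_))))
          (mix-linear s t _ _ _ _)

  𝔼-linear : ∀ n s t (f g : Coins n → ℚ) →
    𝔼 n (λ c → s ℚ.* f c ℚ.+ t ℚ.* g c) ≡ s ℚ.* 𝔼 n f ℚ.+ t ℚ.* 𝔼 n g
  𝔼-linear zero    s t f g = refl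
  𝔼-linear (suc n) s t f g =
    trans (𝔼row-cong n λ r → 𝔼-linear n s t (f ∘ (r ∷_)) (g ∘ (r ∷_)))
          (𝔼row-linear n s t _ _)

  𝔼-+ : ∀ n (f g : Coins n → ℚ) → 𝔼 n (λ c → f c ℚ.+ g c) ≡ 𝔼 n f ℚ.+ 𝔼 n g
  𝔼-+ n f g =
    trans (𝔼-cong n λ c → sym (cong₂ ℚ._+_ (ℚₚ.*-identityˡ (f c)) (ℚₚ.*-identityˡ (g c))))
    (trans (𝔼-linear n 1ℚ 1ℚ f g)
      (cong₂ ℚ._+_ (ℚₚ.*-identityˡ (𝔼 n f)) (ℚₚ.*-identityˡ (𝔼 n g))))

  -- Once entry i is overwritten, averaging over its old value averages equal numbers and collapses
  -- by `mix-idem`; only the average over the new value is left.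
  resample-row : ∀ n (i : Fin n) (f : Vec Bool n → ℚ) →
    𝔼row n (λ r → mix (f (r [ i ]≔ true)) (f (r [ i ]≔ false))) ≡ 𝔼row n f
  resample-row (suc n) zero    f = trans (mix-idem _) (𝔼row-linear n p q _ _)
  resample-row (suc n) (suc i) f =
    cong₂ mix (resample-row n i (f ∘ (true ∷_))) (resample-row n i (f ∘ (false ∷_)))

  module _ (0≤p : 0ℚ ℚ.≤ p) (p≤1 : p ℚ.≤ 1ℚ) where

    0≤q : 0ℚ ℚ.≤ q
    0≤q = subst (ℚ._≤ q) (ℚₚ.+-inverseʳ p) (ℚₚ.+-monoˡ-≤ (ℚ.- p) p≤1)

    mix-mono : ∀ {a b c d} → a ℚ.≤ b → c ℚ.≤ d → mix a c ℚ.≤ mix b d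
    mix-mono a≤b c≤d = ℚₚ.+-mono-≤
      (ℚₚ.*-monoˡ-≤-nonNeg p {{ℚ.nonNegative 0≤p}} a≤b)
      (ℚₚ.*-monoˡ-≤-nonNeg q {{ℚ.nonNegative 0≤q}} c≤d)

    𝔼row-mono : ∀ n {f g : Vec Bool n → ℚ} → (∀ r → f r ℚ.≤ g r) → 𝔼row n f ℚ.≤ 𝔼row n g
    𝔼row-mono zero    h = h []
    𝔼row-mono (suc n) h =
      mix-mono (𝔼row-mono n (h ∘ (true ∷_))) (𝔼row-mono n (h ∘ (false ∷_)))

    𝔼-mono : ∀ n {f g : Coins n → ℚ} → (∀ c → f c ℚ.≤ g c) → 𝔼 n f ℚ.≤ 𝔼 n g
    𝔼-mono zero    h = h []
    𝔼-mono (suc n) h = 𝔼row-mono n λ r → 𝔼-mono n λ c → h (r ∷ c)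

module _ (P : ℝ) (m : ℕ) where
  open Expectation (seq P m)

  sum-rows : ∀ n (g : Vec Bool n → ℚ) →
    sumBy (allRows n) (λ r → seq (rowWeight P r) m ℚ.* g r) ≡ 𝔼row n g
  sum-rows zero    g = trans (ℚₚ.+-identityʳ _) (ℚₚ.*-identityˡ (g []))
  sum-rows (suc n) g =
    trans (sumBy-cartesianProductWith _∷_ (true ∷ false ∷ []) (allRows n)
            (λ r → seq (rowWeight P r) m ℚ.* g r))
    (cong₂ ℚ._+_ (half true) (trans (ℚₚ.+-identityʳ _) (half false)))
    where
    half : ∀ b → sumBy (allRows n) (λ r → seq (rowWeight P (b ∷ r)) m ℚ.* g (b ∷ r))
               ≡ seq (if b then P else 1ℝ - P) m ℚ.* 𝔼row n (g ∘ (b ∷_))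
    half b = trans (sumBy-cong (allRows n) λ r → ℚₚ.*-assoc (seq (if b then P else 1ℝ - P) m) _ _)
      (trans (sumBy-*ˡ (allRows n) (seq (if b then P else 1ℝ - P) m)
               (λ r → seq (rowWeight P r) m ℚ.* g (b ∷ r)))
        (cong (seq (if b then P else 1ℝ - P) m ℚ.*_) (sum-rows n (g ∘ (b ∷_)))))

  sum-coins : ∀ n (g : Coins n → ℚ) →
    sumBy (allCoins n) (λ c → seq (weight P c) m ℚ.* g c) ≡ 𝔼 n g
  sum-coins zero    g = trans (ℚₚ.+-identityʳ _) (ℚₚ.*-identityˡ (g []))
  sum-coins (suc n) g =
    trans (sumBy-cartesianProductWith _∷_ (allRows n) (allCoins n)
            (λ c → seq (weight P c) m ℚ.* g c))
    (trans (sumBy-cong (allRows n) λ r →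
      trans (sumBy-cong (allCoins n) λ c → ℚₚ.*-assoc (seq (rowWeight P r) m) _ _)
        (trans (sumBy-*ˡ (allCoins n) (seq (rowWeight P r) m)
                 (λ c → seq (weight P c) m ℚ.* g (r ∷ c)))
          (cong (seq (rowWeight P r) m ℚ.*_) (sum-coins n (g ∘ (r ∷_))))))
      (sum-rows n (λ r → 𝔼 n (g ∘ (r ∷_)))))

  seq-sum-filter : ∀ {A : Set} {Q : A → Set} (Q? : U.Decidable Q) (w : A → ℝ) (xs : List A) →
    seq (foldr _+_ 0ℝ (map w (filter Q? xs))) m
      ≡ sumBy xs (λ x → seq (w x) m ℚ.* indicator (does (Q? x)))
  seq-sum-filter Q? w []       = refl
  seq-sum-filter Q? w (x ∷ xs) with does (Q? x)
  ... | true  = cong₂ ℚ._+_ (sym (ℚₚ.*-identityʳ (seq (w x) m))) (seq-sum-filter Q? w xs)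
  ... | false = trans (seq-sum-filter Q? w xs)
    (trans (sym (ℚₚ.+-identityˡ _)) (cong (ℚ._+ _) (sym (ℚₚ.*-zeroʳ (seq (w x) m)))))

  -- Arithmetic on `ℝ` is termwise, so the m-th term of the real probability is exactly the
  -- probability for the rational parameter `seq P m`. Every estimate can be made there.
  seq-Pr : ∀ n {E : SimpleGraph n → Set} (E? : U.Decidable E) →
           seq (Pr P n E?) m ≡ 𝔼 n (λ c → indicator (does (E? (graph c))))
  seq-Pr n E? = trans (seq-sum-filter (E? ∘ graph) (weight P) (allCoins n)) (sum-coins n _)

-- Resampling coins; separation of two vertices

setCoin : ∀ {n} → Coins n → Fin n → Fin n → Bool → Coins n
setCoin (r ∷ c) zero    zero    b = r ∷ c
setCoin (r ∷ c) zero    (suc v) b = (r [ v ]≔ b) ∷ c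
setCoin (r ∷ c) (suc u) zero    b = (r [ u ]≔ b) ∷ c
setCoin (r ∷ c) (suc u) (suc v) b = r ∷ setCoin c u v b

coin-set : ∀ {n} (c : Coins n) u v b → u ≢ v → coin (setCoin c u v b) u v ≡ b
coin-set (r ∷ c) zero    zero    b u≢v = contradiction refl u≢v
coin-set (r ∷ c) zero    (suc v) b u≢v = lookup∘update v r b
coin-set (r ∷ c) (suc u) zero    b u≢v = lookup∘update u r b
coin-set (r ∷ c) (suc u) (suc v) b u≢v = coin-set c u v b (u≢v ∘ cong suc)

coin-set-other : ∀ {n} (c : Coins n) u v b w z →
  ¬ (u ≡ w × v ≡ z) → ¬ (u ≡ z × v ≡ w) → coin (setCoin c u v b) w z ≡ coin c w z
coin-set-other (r ∷ c) zero    zero    b w       z       h k = refl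
coin-set-other (r ∷ c) zero    (suc v) b zero    zero    h k = refl
coin-set-other (r ∷ c) zero    (suc v) b zero    (suc z) h k =
  lookup∘update′ (λ { refl → h (refl , refl) }) r b
coin-set-other (r ∷ c) zero    (suc v) b (suc w) zero    h k =
  lookup∘update′ (λ { refl → k (refl , refl) }) r b
coin-set-other (r ∷ c) zero    (suc v) b (suc w) (suc z) h k = refl
coin-set-other (r ∷ c) (suc u) zero    b zero    zero    h k = refl
coin-set-other (r ∷ c) (suc u) zero    b zero    (suc z) h k =
  lookup∘update′ (λ { refl → k (refl , refl) }) r b
coin-set-other (r ∷ c) (suc u) zero    b (suc w) zero    h k =
  lookup∘update′ (λ { refl → h (refl , refl) }) r b
coin-set-other (r ∷ c) (suc u) zero    b (suc w) (suc z) h k = refl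
coin-set-other (r ∷ c) (suc u) (suc v) b zero    zero    h k = refl
coin-set-other (r ∷ c) (suc u) (suc v) b zero    (suc z) h k = refl
coin-set-other (r ∷ c) (suc u) (suc v) b (suc w) zero    h k = refl
coin-set-other (r ∷ c) (suc u) (suc v) b (suc w) (suc z) h k =
  coin-set-other c u v b w z (λ { (refl , refl) → h (refl , refl) })
                             (λ { (refl , refl) → k (refl , refl) })

coin-set-avoids : ∀ {n} (c : Coins n) u v b w z → u ≢ w → u ≢ z →
                  coin (setCoin c u v b) w z ≡ coin c w z
coin-set-avoids c u v b w z u≢w u≢z = coin-set-other c u v b w z (u≢w ∘ proj₁) (u≢z ∘ proj₁)

module _ (p : ℚ) where
  open Expectation p

  -- Stands in for independence: a single coin may be tossed afresh without changing an expectation,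
  -- so any function that does not read this coin acts as a constant in the inner average.
  resample : ∀ n u v (f : Coins n → ℚ) →
    𝔼 n (λ c → mix (f (setCoin c u v true)) (f (setCoin c u v false))) ≡ 𝔼 n f
  resample (suc n) zero    zero    f =
    𝔼row-cong n λ r → 𝔼-cong n λ c → mix-idem (f (r ∷ c))
  resample (suc n) zero    (suc v) f =
    trans (𝔼row-cong n λ r → 𝔼-linear n p q (λ c → f ((r [ v ]≔ true) ∷ c)) (λ c → f ((r [ v ]≔ false) ∷ c)))
      (resample-row n v (λ r → 𝔼 n (f ∘ (r ∷_))))
  resample (suc n) (suc u) zero    f =
    trans (𝔼row-cong n λ r → 𝔼-linear n p q (λ c → f ((r [ u ]≔ true) ∷ c)) (λ c → f ((r [ u ]≔ false) ∷ c)))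
      (resample-row n u (λ r → 𝔼 n (f ∘ (r ∷_))))
  resample (suc n) (suc u) (suc v) f = 𝔼row-cong n λ r → resample n u v (f ∘ (r ∷_))

-- Whether u is adjacent to x while v is neither adjacent nor equal to x, so that
-- d(u,x) = 1 < d(v,x).
near : ∀ {n} → Coins n → Fin n → Fin n → Fin n → Bool
near c u v x = (coin c u x ∧ not (coin c v x)) ∧ not (does (v ≟ᶠ x))

separates : ∀ {n} → Coins n → Fin n → Fin n → Fin n → Fin n → Bool
separates c x y u v = (near c u v x ∧ near c v u y) ∨ (near c v u x ∧ near c u v y)

-- Whether none of the first b pairs in the list that are edges of c separates x and y.
confused : ∀ {n} → List (Fin n × Fin n) → ℕ → Fin n → Fin n → Coins n → Bool
confused []             b       x y c = true
confused (_ ∷ L)        zero    x y c = true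
confused ((u , v) ∷ L)  (suc b) x y c =
  if coin c u v then not (separates c x y u v) ∧ confused L b x y c else confused L (suc b) x y c

-- Matchings and the coins that they leave unread

Avoids : ∀ {n} → Fin n → Fin n × Fin n → Set
Avoids z (u , v) = u ≢ z × v ≢ z

Disjoint : ∀ {n} → Fin n × Fin n → Fin n × Fin n → Set
Disjoint (u , v) e = Avoids u e × Avoids v e

-- Every coin that is read joins two vertices among x, y and the members of the pairs in `L`. One
-- endpoint w outside this set is enough to keep a coin unread.
confused-avoids : ∀ {n} (L : List (Fin n × Fin n)) b x y c w z β →
  All (Avoids w) L → w ≢ x → w ≢ y →
  confused L b x y (setCoin c w z β) ≡ confused L b x y c
confused-avoids []      b       x y c w z β h w≢x w≢y = refl
confused-avoids (_ ∷ L) zero    x y c w z β h w≢x w≢y = refl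
confused-avoids ((u , v) ∷ L) (suc b) x y c w z β ((u≢w , v≢w) ∷ h) w≢x w≢y
  rewrite coin-set-avoids c w z β u v (u≢w ∘ sym) (v≢w ∘ sym)
        | coin-set-avoids c w z β u x (u≢w ∘ sym) w≢x
        | coin-set-avoids c w z β v x (v≢w ∘ sym) w≢x
        | coin-set-avoids c w z β u y (u≢w ∘ sym) w≢y
        | coin-set-avoids c w z β v y (v≢w ∘ sym) w≢y
        | confused-avoids L b x y c w z β h w≢x w≢y
        | confused-avoids L (suc b) x y c w z β h w≢x w≢y = refl

confused-antitone : ∀ {n} (L : List (Fin n × Fin n)) b x y c →
  indicator (confused L (suc b) x y c) ℚ.≤ indicator (confused L b x y c)
confused-antitone [] b x y c = ℚₚ.≤-refl
confused-antitone L@(_ ∷ _) zero x y c = indicator≤1 (confused L 1 x y c)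
confused-antitone ((u , v) ∷ L) (suc b) x y c with coin c u v | separates c x y u v
... | true  | true  = ℚₚ.≤-refl
... | true  | false = confused-antitone L b x y c
... | false | _     = confused-antitone L (suc b) x y c

-- Used for a pair that may be uninformative because it contains x or y. If it is an edge, it
-- consumes one query; if not, giving up one query only makes confusion easier.
confused-head : ∀ {n} e (L : List (Fin n × Fin n)) b x y c →
  indicator (confused (e ∷ L) (suc b) x y c) ℚ.≤ indicator (confused L b x y c)
confused-head (u , v) L b x y c with coin c u v | separates c x y u v
... | true  | true  = 0≤indicator (confused L b x y c)
... | true  | false = ℚₚ.≤-refl
... | false | _     = confused-antitone L b x y c

-- t bounds the number of pairs in the list that contain x or y.
data Meets {n} (x y : Fin n) : ℕ → List (Fin n × Fin n) → Set where
  []   : ∀ {t} → Meets x y t []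
  miss : ∀ {t e L} → Avoids x e → Avoids y e → Meets x y t L → Meets x y t (e ∷ L)
  hit  : ∀ {t e L} → Meets x y t L → Meets x y (suc t) (e ∷ L)

Matching : ∀ {n} → List (Fin n × Fin n) → Set
Matching L = AllPairs Disjoint L × All (λ (u , v) → u ≢ v) L

meets-swap : ∀ {n} {x y : Fin n} {t L} → Meets x y t L → Meets y x t L
meets-swap []           = []
meets-swap (miss h k m) = miss k h (meets-swap m)
meets-swap (hit m)      = hit (meets-swap m)

meets-none : ∀ {n} {x y : Fin n} {L} → All (Avoids x) L → All (Avoids y) L → Meets x y 0 L
meets-none []       []       = []
meets-none (h ∷ hs) (k ∷ ks) = miss h k (meets-none hs ks)

avoids-or-blocks : ∀ {n} (z : Fin n) e → Avoids z e ⊎ (∀ {e′} → Disjoint e e′ → Avoids z e′)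
avoids-or-blocks z (u , v) with u ≟ᶠ z | v ≟ᶠ z
... | yes refl | _        = inj₂ proj₁
... | no u≢z   | yes refl = inj₂ proj₂
... | no u≢z   | no v≢z   = inj₁ (u≢z , v≢z)

meets-once : ∀ {n} {x : Fin n} y {L} → AllPairs Disjoint L → All (Avoids x) L → Meets x y 1 L
meets-once y []       []       = []
meets-once y {e ∷ _} (d ∷ ds) (h ∷ hs) with avoids-or-blocks y e
... | inj₁ k = miss h k (meets-once y ds hs)
... | inj₂ k = hit (meets-none hs (All.map k d))

-- Disjointness puts each of x and y into at most one pair: once a pair contains x, all later ones
-- avoid x.
meets-twice : ∀ {n} (x y : Fin n) {L} → AllPairs Disjoint L → Meets x y 2 L
meets-twice x y [] = []
meets-twice x y {e ∷ _} (d ∷ ds) with avoids-or-blocks x e | avoids-or-blocks y e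
... | inj₁ h | inj₁ k = miss h k (meets-twice x y ds)
... | inj₂ h | _      = hit (meets-once y ds (All.map h d))
... | inj₁ _ | inj₂ k = hit (meets-swap (meets-once x ds (All.map k d)))

-- The pairs (0,1), (2,3), .... They depend on M and n alone, so the list is fixed before any coin
-- is tossed.
matching : ∀ M n → M ℕ.* 2 ℕ.≤ n → List (Fin n × Fin n)
matching zero    n             h                     = []
matching (suc M) (suc (suc n)) (ℕ.s≤s (ℕ.s≤s h)) =
  (zero , suc zero) ∷ map (λ (u , v) → suc (suc u) , suc (suc v)) (matching M n h)

length-matching : ∀ M n h → length (matching M n h) ≡ M
length-matching zero    n             h                 = refl
length-matching (suc M) (suc (suc n)) (ℕ.s≤s (ℕ.s≤s h)) =
  cong suc (trans (length-map _ (matching M n h)) (length-matching M n h))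

matching-isMatching : ∀ M n h → Matching (matching M n h)
matching-isMatching zero    n             h                 = [] , []
matching-isMatching (suc M) (suc (suc n)) (ℕ.s≤s (ℕ.s≤s h)) =
  let ds , ls = matching-isMatching M n h in
  (Allₚ.map⁺ (All.universal (λ _ → ((λ ()) , λ ()) , ((λ ()) , λ ())) _)
     ∷ AllPairsₚ.map⁺ (AllPairs.map
         (λ { ((a , b) , (c , d)) → (a ∘ inj , b ∘ inj) , (c ∘ inj , d ∘ inj) }) ds)) ,
  (λ ()) ∷ Allₚ.map⁺ (All.map (λ u≢v → u≢v ∘ inj) ls)
  where
  inj : ∀ {u v : Fin n} → Fin.suc (Fin.suc u) ≡ suc (suc v) → u ≡ v
  inj refl = refl

-- Probability that two vertices are confused

2ℚ : ℚ
2ℚ = 1ℚ ℚ.+ 1ℚ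

0≤1ℚ : 0ℚ ℚ.≤ 1ℚ
0≤1ℚ = 0≤indicator true

*-nonNeg : ∀ {a b} → 0ℚ ℚ.≤ a → 0ℚ ℚ.≤ b → 0ℚ ℚ.≤ a ℚ.* b
*-nonNeg {a} {b} 0≤a 0≤b = ℚₚ.nonNegative⁻¹ _
  {{ℚₚ.nonNeg*nonNeg⇒nonNeg a {{ℚ.nonNegative 0≤a}} b {{ℚ.nonNegative 0≤b}}}}

+-nonNeg : ∀ {a b} → 0ℚ ℚ.≤ a → 0ℚ ℚ.≤ b → 0ℚ ℚ.≤ a ℚ.+ b
+-nonNeg = ℚₚ.+-mono-≤

≤-by : ∀ {a b} d → 0ℚ ℚ.≤ d → a ℚ.+ d ≡ b → a ℚ.≤ b
≤-by {a} d 0≤d refl = subst (ℚ._≤ a ℚ.+ d) (ℚₚ.+-identityʳ a) (ℚₚ.+-monoʳ-≤ a 0≤d)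

0≤b-a : ∀ {a b} → a ℚ.≤ b → 0ℚ ℚ.≤ b ℚ.- a
0≤b-a {a} {b} a≤b = subst (ℚ._≤ b ℚ.- a) (ℚₚ.+-inverseʳ a) (ℚₚ.+-monoˡ-≤ (ℚ.- a) a≤b)

^-nonNeg : ∀ {a} n → 0ℚ ℚ.≤ a → 0ℚ ℚ.≤ a ^ n
^-nonNeg zero    0≤a = 0≤1ℚ
^-nonNeg (suc n) 0≤a = *-nonNeg 0≤a (^-nonNeg n 0≤a)

^-mono : ∀ {a b} n → 0ℚ ℚ.≤ a → a ℚ.≤ b → a ^ n ℚ.≤ b ^ n
^-mono zero    0≤a a≤b = ℚₚ.≤-refl
^-mono (suc n) 0≤a a≤b =
  *-mono (ℚₚ.≤-trans 0≤a a≤b) (^-nonNeg n 0≤a) a≤b (^-mono n 0≤a a≤b)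

1≤^ : ∀ {a} n → 1ℚ ℚ.≤ a → 1ℚ ℚ.≤ a ^ n
1≤^ zero    1≤a = ℚₚ.≤-refl
1≤^ {a} (suc n) 1≤a = ℚₚ.≤-trans (1≤^ n 1≤a)
  (subst (ℚ._≤ a ^ suc n) (ℚₚ.*-identityˡ (a ^ n))
    (*-mono (ℚₚ.≤-trans 0≤1ℚ 1≤a) (^-nonNeg n (ℚₚ.≤-trans 0≤1ℚ 1≤a)) 1≤a ℚₚ.≤-refl))

1≤2ℚ : 1ℚ ℚ.≤ 2ℚ
1≤2ℚ = ≤-by 1ℚ 0≤1ℚ refl

0≤2ℚ : 0ℚ ℚ.≤ 2ℚ
0≤2ℚ = ℚₚ.≤-trans 0≤1ℚ 1≤2ℚ

module Confusion (p : ℚ) (0≤p : 0ℚ ℚ.≤ p) (p≤1 : p ℚ.≤ 1ℚ) where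
  open Expectation p

  s α β : ℚ
  s = (p ℚ.* p) ℚ.* (q ℚ.* q)
  α = 1ℚ ℚ.- 2ℚ ℚ.* s
  β = 1ℚ ℚ.- ℚ.½ ℚ.* p

  -- 1/16 - s = (1/2 - p)² (1/4 + pq)
  s≤1/16 : s ℚ.≤ ℤ.+ 1 ℚ./ 16
  s≤1/16 = ≤-by _ (*-nonNeg (square (ℚ.½ ℚ.- p))
                   (+-nonNeg (*-nonNeg ½≥0 ½≥0) (*-nonNeg 0≤p (0≤q 0≤p p≤1))))
    (solve 1 (λ p →
      p :* p :* ((con 1ℚ :- p) :* (con 1ℚ :- p))
        :+ (con ℚ.½ :- p) :* (con ℚ.½ :- p) :* (con ℚ.½ :* con ℚ.½ :+ p :* (con 1ℚ :- p))
        := con (ℤ.+ 1 ℚ./ 16)) refl p)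
    where
    open +-*-Solver
    ½≥0 : 0ℚ ℚ.≤ ℚ.½
    ½≥0 = ℚₚ.<⇒≤ ½>0
    square : ∀ a → 0ℚ ℚ.≤ a ℚ.* a
    square a = subst (0ℚ ℚ.≤_) eq (*-nonNeg (ℚₚ.0≤∣p∣ a) (ℚₚ.0≤∣p∣ a))
      where
      eq : ℚ.∣ a ∣ ℚ.* ℚ.∣ a ∣ ≡ a ℚ.* a
      eq with ℚₚ.∣p∣≡p∨∣p∣≡-p a
      ... | inj₁ e = cong₂ ℚ._*_ e e
      ... | inj₂ e = trans (cong₂ ℚ._*_ e e) (solve 1 (λ a → :- a :* :- a := a :* a) refl a)

  -- Crude, since s ≤ 1/16 even gives α ≥ 7/8. In the form 2α ≥ 1 it lets a factor 2 pay for one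
  -- lost query, be it spent on a pair meeting x or y or removed by `pred`.
  ½≤α : ℚ.½ ℚ.≤ α
  ½≤α = ≤-by (2ℚ ℚ.* ((ℤ.+ 1 ℚ./ 16) ℚ.- s) ℚ.+ (ℤ.+ 3 ℚ./ 8))
    (+-nonNeg (*-nonNeg 0≤2ℚ (0≤b-a s≤1/16)) (toWitness {a? = 0ℚ ℚₚ.≤? (ℤ.+ 3 ℚ./ 8)} tt))
    (solve 1 (λ s → con ℚ.½ :+ (con 2ℚ :* (con (ℤ.+ 1 ℚ./ 16) :- s) :+ con (ℤ.+ 3 ℚ./ 8))
                 := con 1ℚ :- con 2ℚ :* s) refl s)
    where open +-*-Solver

  0≤s : 0ℚ ℚ.≤ s
  0≤s = *-nonNeg (*-nonNeg 0≤p 0≤p) (*-nonNeg (0≤q 0≤p p≤1) (0≤q 0≤p p≤1))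

  0≤α : 0ℚ ℚ.≤ α
  0≤α = ℚₚ.≤-trans (ℚₚ.<⇒≤ ½>0) ½≤α

  0≤β : 0ℚ ℚ.≤ β
  0≤β = subst (0ℚ ℚ.≤_) (solve 1 (λ p → con ℚ.½ :+ con ℚ.½ :* (con 1ℚ :- p) := con 1ℚ :- con ℚ.½ :* p) refl p)
    (+-nonNeg (ℚₚ.<⇒≤ ½>0) (*-nonNeg (ℚₚ.<⇒≤ ½>0) (0≤q 0≤p p≤1)))
    where open +-*-Solver

  -- From the outside in, the averages run over the coins vy, uy, vx, ux; the innermost one, over
  -- uv, is `X` if the other four do not separate x from y and `Y` if they do. The two leaves `Y`
  -- are the two separating patterns, each of weight s, and `Y` is smaller than `X` by p·a, so the
  -- total is `X` minus 2s·p·a.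
  separation : ∀ a b →
    (let X = mix a b
         Y = mix 0ℚ b) →
    mix (mix (mix (mix X X) (mix X X)) (mix (mix X X) (mix Y X)))
        (mix (mix (mix X Y) (mix X X)) (mix (mix X X) (mix X X)))
    ≡ mix (α ℚ.* a) b
  separation a b = solve 3 (λ p a b →
      let m = λ a b → p :* a :+ (con 1ℚ :- p) :* b
          X = m a b
          Y = m (con 0ℚ) b
      in m (m (m (m X X) (m X X)) (m (m X X) (m Y X)))
           (m (m (m X Y) (m X X)) (m (m X X) (m X X)))
         := m ((con 1ℚ :- con 2ℚ :* (p :* p :* ((con 1ℚ :- p) :* (con 1ℚ :- p)))) :* a) b)
    refl p a b
    where open +-*-Solver

  Mix : (Bool → ℚ) → ℚ
  Mix g = mix (g true) (g false)

  Mix-cong : ∀ {g h : Bool → ℚ} → (∀ b → g b ≡ h b) → Mix g ≡ Mix h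
  Mix-cong e = cong₂ mix (e true) (e false)

  -- The coins uv, ux, vx, uy, vy are distinct and unread by `L`. Redrawing all five makes the
  -- outcomes for the tail constants `a` and `b` in the average that `separation` evaluates.
  confused-step : ∀ n {u v x y : Fin n} L b → u ≢ v → x ≢ y → Avoids x (u , v) → Avoids y (u , v) →
    All (Avoids u) L → All (Avoids v) L →
    𝔼 n (λ c → indicator (confused ((u , v) ∷ L) (suc b) x y c))
      ≡ (p ℚ.* α) ℚ.* 𝔼 n (λ c → indicator (confused L b x y c))
        ℚ.+ q ℚ.* 𝔼 n (λ c → indicator (confused L (suc b) x y c))
  confused-step n {u} {v} {x} {y} L b u≢v x≢y (u≢x , v≢x) (u≢y , v≢y) L∌u L∌v =
    trans (sym (trans (resample p n v y f₄) (trans (resample p n u y f₃) (trans (resample p n v x f₂)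
      (trans (resample p n u x f₁) (resample p n u v f))))))
    (trans (𝔼-cong n average) (𝔼-linear n (p ℚ.* α) q _ _))
    where
    f f₁ f₂ f₃ f₄ : Coins n → ℚ
    f  c = indicator (confused ((u , v) ∷ L) (suc b) x y c)
    f₁ c = Mix (f ∘ setCoin c u v)
    f₂ c = Mix (f₁ ∘ setCoin c u x)
    f₃ c = Mix (f₂ ∘ setCoin c v x)
    f₄ c = Mix (f₃ ∘ setCoin c u y)
    module _ (c : Coins n) where
      -- The factors `true` are the inequality tests in `near`, settled because x and y avoid the
      -- pair.
      outcome : Bool → Bool → Bool → Bool → Bool → Bool
      outcome vy uy vx ux uv = if uv
        then not ((((ux ∧ not vx) ∧ true) ∧ ((vy ∧ not uy) ∧ true))
               ∨ (((vx ∧ not ux) ∧ true) ∧ ((uy ∧ not vy) ∧ true))) ∧ confused L b x y c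
        else confused L (suc b) x y c
      module _ (vy uy vx ux uv : Bool) where
        c₁ = setCoin c v y vy
        c₂ = setCoin c₁ u y uy
        c₃ = setCoin c₂ v x vx
        c₄ = setCoin c₃ u x ux
        c₅ = setCoin c₄ u v uv
        e-uv : coin c₅ u v ≡ uv
        e-uv = coin-set c₄ u v uv u≢v
        e-ux : coin c₅ u x ≡ ux
        e-ux = trans (coin-set-other c₄ u v uv u x (v≢x ∘ proj₂) (u≢x ∘ proj₁)) (coin-set c₃ u x ux u≢x)
        e-vx : coin c₅ v x ≡ vx
        e-vx = trans (coin-set-avoids c₄ u v uv v x u≢v u≢x)
          (trans (coin-set-avoids c₃ u x ux v x u≢v u≢x) (coin-set c₂ v x vx v≢x))
        e-uy : coin c₅ u y ≡ uy
        e-uy = trans (coin-set-other c₄ u v uv u y (v≢y ∘ proj₂) (u≢y ∘ proj₁))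
          (trans (coin-set-other c₃ u x ux u y (x≢y ∘ proj₂) (u≢y ∘ proj₁))
          (trans (coin-set-avoids c₂ v x vx u y (u≢v ∘ sym) v≢y) (coin-set c₁ u y uy u≢y)))
        e-vy : coin c₅ v y ≡ vy
        e-vy = trans (coin-set-avoids c₄ u v uv v y u≢v u≢y)
          (trans (coin-set-avoids c₃ u x ux v y u≢v u≢y)
          (trans (coin-set-other c₂ v x vx v y (x≢y ∘ proj₂) (v≢y ∘ proj₁))
          (trans (coin-set-avoids c₁ u y uy v y u≢v u≢y) (coin-set c v y vy v≢y))))
        e-confused : ∀ b → confused L b x y c₅ ≡ confused L b x y c
        e-confused b = trans (confused-avoids L b x y c₄ u v uv L∌u u≢x u≢y)
          (trans (confused-avoids L b x y c₃ u x ux L∌u u≢x u≢y)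
          (trans (confused-avoids L b x y c₂ v x vx L∌v v≢x v≢y)
          (trans (confused-avoids L b x y c₁ u y uy L∌u u≢x u≢y)
                 (confused-avoids L b x y c  v y vy L∌v v≢x v≢y))))
        leaf : f c₅ ≡ indicator (outcome vy uy vx ux uv)
        leaf
          rewrite e-uv | e-ux | e-vx | e-uy | e-vy | e-confused b | e-confused (suc b)
                | dec-false (v ≟ᶠ x) v≢x | dec-false (u ≟ᶠ y) u≢y
                | dec-false (u ≟ᶠ x) u≢x | dec-false (v ≟ᶠ y) v≢y = refl
      average : Mix (f₄ ∘ setCoin c v y)
              ≡ (p ℚ.* α) ℚ.* indicator (confused L b x y c)
                ℚ.+ q ℚ.* indicator (confused L (suc b) x y c)
      average = trans
        (Mix-cong λ vy → Mix-cong λ uy → Mix-cong λ vx → Mix-cong λ ux → Mix-cong λ uv →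
          leaf vy uy vx ux uv)
        (trans (separation (indicator (confused L b x y c)) (indicator (confused L (suc b) x y c)))
          (cong (ℚ._+ q ℚ.* indicator (confused L (suc b) x y c))
            (sym (ℚₚ.*-assoc p α (indicator (confused L b x y c))))))

  -- First term: b edges fail to separate x and y, except that each of the t pairs meeting x or y
  -- is useless, which costs a factor 1/α ≤ 2.  Second term: the number X of edges among the M
  -- pairs is less than b, which has probability at most 2^b 𝔼[2^-X] = 2^b β^M.
  confusion-bound : ℕ → ℕ → ℕ → ℚ
  confusion-bound t b M = 2ℚ ^ t ℚ.* α ^ b ℚ.+ 2ℚ ^ b ℚ.* β ^ M

  private
    0≤2^ : ∀ n → 0ℚ ℚ.≤ 2ℚ ^ n
    0≤2^ n = ^-nonNeg n 0≤2ℚ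

  α≤1 : α ℚ.≤ 1ℚ
  α≤1 = ≤-by (2ℚ ℚ.* s) (*-nonNeg 0≤2ℚ 0≤s)
    (solve 1 (λ s → con 1ℚ :- con 2ℚ :* s :+ con 2ℚ :* s := con 1ℚ) refl s)
    where open +-*-Solver

  -- The bound is a supersolution of the recursion in `confused-step`: its first term satisfies it
  -- exactly, as pα·α^b + q·α^(b+1) = α^(b+1), and its second with a surplus proportional to p(1-α).
  𝔼-confused : ∀ n {x y : Fin n} {t} L b → x ≢ y → Matching L → Meets x y t L →
    𝔼 n (λ c → indicator (confused L b x y c)) ℚ.≤ confusion-bound t b (length L)
  -- The pairs have run out: the second term alone is 2^b ≥ 1.
  𝔼-confused n {t = t} [] b x≢y m h = ℚₚ.≤-trans (ℚₚ.≤-reflexive (𝔼-const n 1ℚ))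
    (ℚₚ.≤-trans (subst (1ℚ ℚ.≤_) (sym (ℚₚ.*-identityʳ (2ℚ ^ b))) (1≤^ b 1≤2ℚ))
      (≤-by (2ℚ ^ t ℚ.* α ^ b) (*-nonNeg (0≤2^ t) (^-nonNeg b 0≤α)) (ℚₚ.+-comm (2ℚ ^ b ℚ.* 1ℚ) _)))
  -- The queries have run out: the first term alone is 2^t ≥ 1.
  𝔼-confused n {t = t} L@(_ ∷ _) zero x≢y m h = ℚₚ.≤-trans (ℚₚ.≤-reflexive (𝔼-const n 1ℚ))
    (ℚₚ.≤-trans (subst (1ℚ ℚ.≤_) (sym (ℚₚ.*-identityʳ (2ℚ ^ t))) (1≤^ t 1≤2ℚ))
      (≤-by (2ℚ ^ 0 ℚ.* β ^ length L) (*-nonNeg (0≤2^ 0) (^-nonNeg (length L) 0≤β)) refl))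
  𝔼-confused n {t = t} (e ∷ L) (suc b) x≢y (d ∷ ds , u≢v ∷ ls) (miss hx hy h) =
    ℚₚ.≤-trans (ℚₚ.≤-reflexive (confused-step n L b u≢v x≢y hx hy (All.map proj₁ d) (All.map proj₂ d)))
    (ℚₚ.≤-trans (ℚₚ.+-mono-≤
        (ℚₚ.*-monoˡ-≤-nonNeg (p ℚ.* α) {{ℚ.nonNegative (*-nonNeg 0≤p 0≤α)}}
          (𝔼-confused n L b x≢y (ds , ls) h))
        (ℚₚ.*-monoˡ-≤-nonNeg q {{ℚ.nonNegative (0≤q 0≤p p≤1)}}
          (𝔼-confused n L (suc b) x≢y (ds , ls) h)))
      (≤-by (2ℚ ^ b ℚ.* β ^ length L ℚ.* (p ℚ.* (1ℚ ℚ.- α)))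
        (*-nonNeg (*-nonNeg (0≤2^ b) (^-nonNeg (length L) 0≤β)) (*-nonNeg 0≤p (0≤b-a α≤1)))
        (solve 6 (λ C A D B p a →
            let q = con 1ℚ :- p
            in (p :* a) :* (C :* A :+ D :* B)
                 :+ q :* (C :* (a :* A) :+ con 2ℚ :* D :* B)
                 :+ D :* B :* (p :* (con 1ℚ :- a))
               := C :* (a :* A) :+ con 2ℚ :* D :* ((con 1ℚ :- con ℚ.½ :* p) :* B))
          refl (2ℚ ^ t) (α ^ b) (2ℚ ^ b) (β ^ length L) p α)))
    where open +-*-Solver
  -- One pair and one query are written off. The first term absorbs this by 2α ≥ 1, the second by 2β
  -- = 2 - p ≥ 1.
  𝔼-confused n {t = suc t} (e ∷ L) (suc b) x≢y (_ ∷ ds , _ ∷ ls) (hit h) =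
    ℚₚ.≤-trans (𝔼-mono 0≤p p≤1 n (confused-head e L b _ _))
    (ℚₚ.≤-trans (𝔼-confused n L b x≢y (ds , ls) h)
      (≤-by (2ℚ ℚ.* (2ℚ ^ t ℚ.* α ^ b) ℚ.* (α ℚ.- ℚ.½) ℚ.+ 2ℚ ^ b ℚ.* β ^ length L ℚ.* q)
        (+-nonNeg
          (*-nonNeg (*-nonNeg 0≤2ℚ (*-nonNeg (0≤2^ t) (^-nonNeg b 0≤α))) (0≤b-a ½≤α))
          (*-nonNeg (*-nonNeg (0≤2^ b) (^-nonNeg (length L) 0≤β)) (0≤q 0≤p p≤1)))
        (solve 6 (λ C A D B p a →
            C :* A :+ D :* B
              :+ (con 2ℚ :* (C :* A) :* (a :- con ℚ.½) :+ D :* B :* (con 1ℚ :- p))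
            := con 2ℚ :* C :* (a :* A) :+ con 2ℚ :* D :* ((con 1ℚ :- con ℚ.½ :* p) :* B))
          refl (2ℚ ^ t) (α ^ b) (2ℚ ^ b) (β ^ length L) p α)))
    where open +-*-Solver

-- From separating edges to the query game

shortest-lower : ∀ {n} (G : SimpleGraph n) u v l fuel → [ l ] ≤⁺ shortest G u v l fuel
shortest-lower G u v l zero       = [ l ] ≤⊤⁺
shortest-lower G u v l (suc fuel) with does (walk? G l u v)
... | true  = [ ℕₚ.≤-refl ]
... | false = ≤⁺-trans ℕₚ.≤-trans [ ℕₚ.n≤1+n l ] (shortest-lower G u v (suc l) fuel)

dist-adjacent : ∀ {n} (c : Coins n) u x → coin c u x ≡ true → dist (graph c) u x ≤⁺ [ 1 ]
dist-adjacent {suc zero} ([] ∷ []) zero zero ()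
dist-adjacent {suc (suc n)} c u x ux with does (walk? (graph c) 0 u x)
... | true  = [ ℕ.z≤n ]
... | false rewrite dec-true (walk? (graph c) 1 u x) (step (Equivalence.from T-≡ ux) here) =
  [ ℕₚ.≤-refl ]

dist-far : ∀ {n} (c : Coins n) u x → coin c u x ≡ false → u ≢ x → [ 2 ] ≤⁺ dist (graph c) u x
dist-far {suc zero} ([] ∷ []) zero zero ux u≢x = contradiction refl u≢x
dist-far {suc (suc n)} c u x ux u≢x
  rewrite dec-false (walk? (graph c) 0 u x) (λ { here → u≢x refl })
        | dec-false (walk? (graph c) 1 u x) (λ { (step a here) → subst T ux a }) =
  shortest-lower (graph c) u x 2 n

-- Were `near c v u x` true, then d(v,x) ≤ 1 < 2 ≤ d(u,x), and the reply u would have discarded x.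
closer⇒¬near : ∀ {n} (c : Coins n) u v x → x ∈ closer (graph c) u v → near c v u x ≡ false
closer⇒¬near c u v x x∈ with coin c v x in vx | coin c u x in ux | u ≟ᶠ x
... | false | _     | _       = refl
... | true  | true  | _       = refl
... | true  | false | yes u≡x = refl
... | true  | false | no  u≢x = contradiction
  (≤⁺-trans ℕₚ.≤-trans (dist-far c u x ux u≢x)
    (≤⁺-trans ℕₚ.≤-trans d (dist-adjacent c v x vx)))
  λ { [ ℕ.s≤s () ] }
  where
  d : dist (graph c) u x ≤⁺ dist (graph c) v x
  d = toWitness {a? = ≤⁺-dec ℕ._≤?_ (dist (graph c) u x) (dist (graph c) v x)}
    (Equivalence.from T-≡ (trans (isYes≗does (≤⁺-dec ℕ._≤?_ (dist (graph c) u x) (dist (graph c) v x)))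
      (trans (sym (lookup∘tabulate _ x)) ([]=⇒lookup x∈))))

size-singleton : ∀ {n} (S : Subset n) → Nonempty S → (∀ x y → x ∈ S → y ∈ S → x ≡ y) → size S ≡ 1
size-singleton S (x , x∈S) unique = trans
  (cong size (⊆-antisym {i = S} {⁅ x ⁆}
    (λ {y} y∈S → subst (_∈ ⁅ x ⁆) (unique x y x∈S y∈S) (x∈⁅x⁆ x))
    (λ {y} y∈x → subst (_∈ S) (sym (x∈⁅y⁆⇒x≡y x y∈x)) x∈S)))
  (∣⁅x⁆∣≡1 x)

module _ {n} (c : Coins n) where

  Resolved : List (Fin n × Fin n) → ℕ → Subset n → Set
  Resolved L b S = ∀ x y → x ∈ S → y ∈ S → x ≢ y → confused L b x y c ≡ false

  unique : ∀ L b S → (∀ x y → confused L b x y c ≡ true) → Resolved L b S →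
           ∀ x y → x ∈ S → y ∈ S → x ≡ y
  unique L b S h r x y x∈S y∈S with x ≟ᶠ y
  ... | yes e = e
  ... | no ne = contradiction (trans (sym (h x y)) (r x y x∈S y∈S ne)) λ ()

  -- The strategy walks along the list, passes over non-edges at no cost and queries the edges. When
  -- the pairs or the queries run out, `confused` is true by definition, so `Resolved` admits only
  -- one candidate.
  locates : ∀ L b S → Nonempty S → Resolved L b S → LocatesWithin (graph c) (Adjacent (graph c)) b S
  locates [] b S ne r = located (size-singleton S ne (unique [] b S (λ _ _ → refl) r))
  locates L@(_ ∷ _) zero S ne r = located (size-singleton S ne (unique L zero S (λ _ _ → refl) r))
  locates ((u , v) ∷ L) (suc b) S ne r = split (coin c u v) refl
    where
    split : ∀ β → coin c u v ≡ β → LocatesWithin (graph c) (Adjacent (graph c)) (suc b) S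
    split false uv = locates L (suc b) S ne λ x y x∈S y∈S x≢y →
      trans (cong (λ β → if β then not (separates c x y u v) ∧ confused L b x y c
                             else confused L (suc b) x y c) (sym uv))
        (r x y x∈S y∈S x≢y)
    split true uv = query u v (Equivalence.from T-≡ uv)
      -- After the reply u neither survivor is near v, which falsifies one factor in each of the two
      -- separating patterns; hence this edge did not separate them and a later one must.
      (λ ne′ → locates L b _ ne′ λ x y x∈ y∈ x≢y →
        let x∈S , x∈c = x∈p∩q⁻ S _ x∈ ; y∈S , y∈c = x∈p∩q⁻ S _ y∈ in
        remaining x y (r x y x∈S y∈S x≢y)
          (cong₂ _∨_ (trans (cong (near c u v x ∧_) (closer⇒¬near c u v y y∈c)) (∧-zeroʳ _))
                     (cong (_∧ near c u v y) (closer⇒¬near c u v x x∈c))))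
      (λ ne′ → locates L b _ ne′ λ x y x∈ y∈ x≢y →
        let x∈S , x∈c = x∈p∩q⁻ S _ x∈ ; y∈S , y∈c = x∈p∩q⁻ S _ y∈ in
        remaining x y (r x y x∈S y∈S x≢y)
          (cong₂ _∨_ (cong (_∧ near c v u y) (closer⇒¬near c v u x x∈c))
                     (trans (cong (near c v u x ∧_) (closer⇒¬near c v u y y∈c)) (∧-zeroʳ _))))
      where
      remaining : ∀ x y → confused ((u , v) ∷ L) (suc b) x y c ≡ false →
                  separates c x y u v ≡ false → confused L b x y c ≡ false
      remaining x y e s rewrite uv | s = e

locates-mono : ∀ {n} {G : SimpleGraph n} {R R′ : Rel (Fin n) 0ℓ} → (∀ {u v} → R u v → R′ u v) →
               ∀ {t S} → LocatesWithin G R t S → LocatesWithin G R′ t S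
locates-mono h (located e)       = located e
locates-mono h (query u v a f g) =
  query u v (h a) (locates-mono h ∘ f) (locates-mono h ∘ g)

locates-weaken : ∀ {n} {G : SimpleGraph n} {R : Rel (Fin n) 0ℓ} {s t S} → s ℕ.≤ t →
                 LocatesWithin G R s S → LocatesWithin G R t S
locates-weaken s≤t           (located e)       = located e
locates-weaken (ℕ.s≤s s≤t) (query u v a f g) =
  query u v a (locates-weaken s≤t ∘ f) (locates-weaken s≤t ∘ g)

least-below : ∀ {P : ℕ → Set} → U.Decidable P → ∀ b → P b → ∃ λ a → IsLeast P a × a ℕ.≤ b
least-below {P} P? = <-rec _ λ b rec Pb → search b rec Pb (ℕₚ.anyUpTo? P? b)
  where
  search : ∀ b → (∀ {j} → j ℕ.< b → P j → ∃ λ a → IsLeast P a × a ℕ.≤ j) → P b →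
           Dec (∃ λ j → j ℕ.< b × P j) → ∃ λ a → IsLeast P a × a ℕ.≤ b
  search b rec Pb (yes (j , j<b , Pj)) =
    let a , least , a≤j = rec j<b Pj in a , least , ℕₚ.≤-trans a≤j (ℕₚ.<⇒≤ j<b)
  search b rec Pb (no none) =
    b , (Pb , λ j Pj → ℕₚ.≮⇒≥ λ j<b → none (j , j<b , Pj)) , ℕₚ.≤-refl

pq≤eq≤-fromEdges : ∀ {n} (G : SimpleGraph n) k → LocatesWithin G (Adjacent G) k ⊤ → Pq≤Eq≤ k G
pq≤eq≤-fromEdges G k h =
  let b , eqG , b≤k = least-below (λ t → locatesWithin? G (λ u v → T? (adj G u v)) t ⊤) k h
      a , pqG , a≤b = least-below (λ t → locatesWithin? G (λ _ _ → yes tt) t ⊤) b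
                        (locates-mono (λ _ → tt) (proj₁ eqG))
  in a , b , pqG , eqG , a≤b , b≤k

-- Union bound over pairs of vertices

sumBy-nonNeg : {A : Set} (xs : List A) {g : A → ℚ} → (∀ a → 0ℚ ℚ.≤ g a) → 0ℚ ℚ.≤ sumBy xs g
sumBy-nonNeg []       h = ℚₚ.≤-refl
sumBy-nonNeg (x ∷ xs) h = +-nonNeg (h x) (sumBy-nonNeg xs h)

-- The dichotomy behind the first-moment method: one bad entry already contributes 1 to the sum.
all⊎1≤sumBy : {A : Set} {Q : A → Set} (xs : List A) {g : A → ℚ} → (∀ a → 0ℚ ℚ.≤ g a) →
              (∀ a → Q a ⊎ 1ℚ ℚ.≤ g a) → All Q xs ⊎ 1ℚ ℚ.≤ sumBy xs g
all⊎1≤sumBy [] 0≤g h = inj₁ []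
all⊎1≤sumBy (x ∷ xs) {g} 0≤g h with h x | all⊎1≤sumBy xs 0≤g h
... | inj₁ Qx  | inj₁ Qxs   = inj₁ (Qx ∷ Qxs)
... | inj₂ 1≤g | _          = inj₂ (subst (ℚ._≤ sumBy (x ∷ xs) g) (ℚₚ.+-identityʳ 1ℚ)
                                      (ℚₚ.+-mono-≤ 1≤g (sumBy-nonNeg xs 0≤g)))
... | inj₁ _   | inj₂ 1≤sum = inj₂ (ℚₚ.+-mono-≤ (0≤g x) 1≤sum)

ι : ℕ → ℚ
ι n = ℤ.+ n ℚ./ 1

ι-suc : ∀ n → ι (suc n) ≡ 1ℚ ℚ.+ ι n
ι-suc n = sym (frac-suc n 0)

ι-suc-* : ∀ n B → B ℚ.+ ι n ℚ.* B ≡ ι (suc n) ℚ.* B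
ι-suc-* n B = trans (solve 2 (λ a B → B :+ a :* B := (con 1ℚ :+ a) :* B) refl (ι n) B)
                    (cong (ℚ._* B) (sym (ι-suc n)))
  where open +-*-Solver

module Failure (p : ℚ) (0≤p : 0ℚ ℚ.≤ p) (p≤1 : p ℚ.≤ 1ℚ) where
  open Expectation p
  open Confusion p 0≤p p≤1

  𝔼-sumBy : ∀ n {A : Set} (xs : List A) (h : A → Coins n → ℚ) B → (∀ a → 𝔼 n (h a) ℚ.≤ B) →
            𝔼 n (λ c → sumBy xs (λ a → h a c)) ℚ.≤ ι (length xs) ℚ.* B
  𝔼-sumBy n []       h B h≤B = ℚₚ.≤-reflexive (trans (𝔼-const n 0ℚ) (sym (ℚₚ.*-zeroˡ B)))
  𝔼-sumBy n (x ∷ xs) h B h≤B = subst₂ ℚ._≤_ (sym (𝔼-+ n (h x) _)) (ι-suc-* (length xs) B)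
    (ℚₚ.+-mono-≤ (h≤B x) (𝔼-sumBy n xs h B h≤B))

  module _ (n : ℕ) (L : List (Fin n × Fin n)) (L-matching : Matching L) (b : ℕ) where

    clash : Fin n → Fin n → Coins n → Bool
    clash x y c = not (does (x ≟ᶠ y)) ∧ confused L b x y c

    clashes : Coins n → ℚ
    clashes c = sumBy (allFin n) λ x → sumBy (allFin n) λ y → indicator (clash x y c)

    B : ℚ
    B = confusion-bound 2 b (length L)

    0≤B : 0ℚ ℚ.≤ B
    0≤B = +-nonNeg (*-nonNeg (^-nonNeg 2 0≤2ℚ) (^-nonNeg b 0≤α))
                   (*-nonNeg (^-nonNeg b 0≤2ℚ) (^-nonNeg (length L) 0≤β))

    𝔼-clash : ∀ x y → 𝔼 n (λ c → indicator (clash x y c)) ℚ.≤ B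
    𝔼-clash x y with x ≟ᶠ y
    ... | yes x≡y = ℚₚ.≤-trans (ℚₚ.≤-reflexive (𝔼-const n 0ℚ)) 0≤B
    ... | no  x≢y = 𝔼-confused n L b x≢y L-matching (meets-twice x y (proj₁ L-matching))

    length-allFin : length (allFin n) ≡ n
    length-allFin = length-tabulate id

    𝔼-clashes : 𝔼 n clashes ℚ.≤ ι n ℚ.* (ι n ℚ.* B)
    𝔼-clashes = subst (λ l → 𝔼 n clashes ℚ.≤ ι l ℚ.* (ι n ℚ.* B)) length-allFin
      (𝔼-sumBy n (allFin n) _ (ι n ℚ.* B) λ x →
        subst (λ l → 𝔼 n (λ c → sumBy (allFin n) (λ y → indicator (clash x y c))) ℚ.≤ ι l ℚ.* B)
          length-allFin (𝔼-sumBy n (allFin n) (λ y c → indicator (clash x y c)) B (𝔼-clash x)))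

    module _ (1≤n : 1 ℕ.≤ n) {E : SimpleGraph n → Set} (E? : U.Decidable E)
             (easy : ∀ G → LocatesWithin G (Adjacent G) b ⊤ → E G) where

      -- A pointwise inequality: without clashes `locates` applies, and otherwise the clashes count
      -- for at least 1. Taking expectations turns it into `failure`.
      success : ∀ c → 1ℚ ℚ.≤ indicator (does (E? (graph c))) ℚ.+ clashes c
      success c = split (E? (graph c))
        (all⊎1≤sumBy {Q = λ x → All (λ y → clash x y c ≡ false) (allFin n)} (allFin n)
          (λ x → sumBy-nonNeg (allFin n) λ y → 0≤indicator (clash x y c))
          (λ x → all⊎1≤sumBy (allFin n) (λ y → 0≤indicator (clash x y c)) λ y → decide (clash x y c)))
        where
        decide : ∀ β → β ≡ false ⊎ 1ℚ ℚ.≤ indicator β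
        decide true  = inj₂ ℚₚ.≤-refl
        decide false = inj₁ refl
        vertex : ∀ {n} → 1 ℕ.≤ n → Fin n
        vertex (ℕ.s≤s _) = zero
        resolved : ∀ x y → x ≢ y → clash x y c ≡ false → confused L b x y c ≡ false
        resolved x y x≢y e rewrite dec-false (x ≟ᶠ y) x≢y = e
        split : (d : Dec (E (graph c))) →
                All (λ x → All (λ y → clash x y c ≡ false) (allFin n)) (allFin n) ⊎ 1ℚ ℚ.≤ clashes c →
                1ℚ ℚ.≤ indicator (does d) ℚ.+ clashes c
        split (yes _) _            = ℚₚ.+-monoʳ-≤ 1ℚ
          (sumBy-nonNeg (allFin n) λ x → sumBy-nonNeg (allFin n) λ y → 0≤indicator (clash x y c))
        split (no _)  (inj₂ 1≤sum) = subst (1ℚ ℚ.≤_) (sym (ℚₚ.+-identityˡ (clashes c))) 1≤sum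
        split (no ¬E) (inj₁ none)  = contradiction
          (easy (graph c) (locates c L b ⊤ (vertex 1≤n , ∈⊤) λ x y _ _ x≢y →
            resolved x y x≢y (All.lookup (All.lookup none (∈-allFin x)) (∈-allFin y))))
          ¬E

      failure : 1ℚ ℚ.≤ 𝔼 n (λ c → indicator (does (E? (graph c)))) ℚ.+ ι n ℚ.* (ι n ℚ.* B)
      failure = begin
        1ℚ                                ≡⟨ 𝔼-const n 1ℚ ⟨
        𝔼 n (λ _ → 1ℚ)                    ≤⟨ 𝔼-mono 0≤p p≤1 n success ⟩
        𝔼 n (λ c → good c ℚ.+ clashes c)  ≡⟨ 𝔼-+ n good clashes ⟩
        𝔼 n good ℚ.+ 𝔼 n clashes          ≤⟨ ℚₚ.+-monoʳ-≤ (𝔼 n good) 𝔼-clashes ⟩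
        𝔼 n good ℚ.+ ι n ℚ.* (ι n ℚ.* B)  ∎
        where
        open ℚₚ.≤-Reasoning
        good : Coins n → ℚ
        good c = indicator (does (E? (graph c)))

  𝔼-indicator≤1 : ∀ n (g : Coins n → Bool) → 𝔼 n (indicator ∘ g) ℚ.≤ 1ℚ
  𝔼-indicator≤1 n g = ℚₚ.≤-trans (𝔼-mono 0≤p p≤1 n (indicator≤1 ∘ g)) (ℚₚ.≤-reflexive (𝔼-const n 1ℚ))

-- Elementary estimates

ι-mono : ∀ {m n} → m ℕ.≤ n → ι m ℚ.≤ ι n
ι-mono {m} {n} m≤n = frac-mono m 0 n 0 (ℕₚ.*-monoˡ-≤ 1 m≤n)

0≤ι : ∀ n → 0ℚ ℚ.≤ ι n
0≤ι n = ι-mono {0} {n} ℕ.z≤n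

ι-cancel : ∀ {m n} → ι m ℚ.≤ ι n → m ℕ.≤ n
ι-cancel {m} {n} h = ℕₚ.≮⇒≥ λ n<m → ℚₚ.<-irrefl refl (begin-strict
  ι n            ≡⟨ ℚₚ.+-identityˡ (ι n) ⟨
  0ℚ ℚ.+ ι n     <⟨ ℚₚ.+-monoˡ-< (ι n) (ℚₚ.positive⁻¹ 1ℚ) ⟩
  1ℚ ℚ.+ ι n     ≡⟨ ι-suc n ⟨
  ι (suc n)      ≤⟨ ι-mono n<m ⟩
  ι m            ≤⟨ h ⟩
  ι n            ∎)
  where open ℚₚ.≤-Reasoning

ι-+ : ∀ m n → ι (m ℕ.+ n) ≡ ι m ℚ.+ ι n
ι-+ zero    n = sym (ℚₚ.+-identityˡ (ι n))
ι-+ (suc m) n = begin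
  ι (suc (m ℕ.+ n))       ≡⟨ ι-suc (m ℕ.+ n) ⟩
  1ℚ ℚ.+ ι (m ℕ.+ n)      ≡⟨ cong (1ℚ ℚ.+_) (ι-+ m n) ⟩
  1ℚ ℚ.+ (ι m ℚ.+ ι n)    ≡⟨ ℚₚ.+-assoc 1ℚ (ι m) (ι n) ⟨
  1ℚ ℚ.+ ι m ℚ.+ ι n      ≡⟨ cong (ℚ._+ ι n) (ι-suc m) ⟨
  ι (suc m) ℚ.+ ι n       ∎
  where open ≡-Reasoning

ι-* : ∀ m n → ι (m ℕ.* n) ≡ ι m ℚ.* ι n
ι-* zero    n = sym (ℚₚ.*-zeroˡ (ι n))
ι-* (suc m) n = begin
  ι (n ℕ.+ m ℕ.* n)          ≡⟨ ι-+ n (m ℕ.* n) ⟩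
  ι n ℚ.+ ι (m ℕ.* n)        ≡⟨ cong (ι n ℚ.+_) (ι-* m n) ⟩
  ι n ℚ.+ ι m ℚ.* ι n        ≡⟨ solve 2 (λ a b → b :+ a :* b := (con 1ℚ :+ a) :* b) refl (ι m) (ι n) ⟩
  (1ℚ ℚ.+ ι m) ℚ.* ι n       ≡⟨ cong (ℚ._* ι n) (ι-suc m) ⟨
  ι (suc m) ℚ.* ι n          ∎
  where
  open ≡-Reasoning
  open +-*-Solver

ι-2^ : ∀ j → ι (2 ℕ.^ j) ≡ 2ℚ ^ j
ι-2^ zero    = refl
ι-2^ (suc j) = trans (ι-* 2 (2 ℕ.^ j)) (cong (2ℚ ℚ.*_) (ι-2^ j))

ι-/ : ∀ a d → ι a ℚ.* 1/suc d ≡ ℤ.+ a ℚ./ suc d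
ι-/ zero    d = trans (ℚₚ.*-zeroˡ (1/suc d)) (sym (ℚₚ.0/n≡0 (suc d)))
ι-/ (suc a) d = begin
  ι (suc a) ℚ.* 1/suc d            ≡⟨ cong (ℚ._* 1/suc d) (ι-suc a) ⟩
  (1ℚ ℚ.+ ι a) ℚ.* 1/suc d         ≡⟨ solve 2 (λ a b → (con 1ℚ :+ a) :* b := b :+ a :* b) refl (ι a) (1/suc d) ⟩
  1/suc d ℚ.+ ι a ℚ.* 1/suc d      ≡⟨ cong (1/suc d ℚ.+_) (ι-/ a d) ⟩
  1/suc d ℚ.+ ℤ.+ a ℚ./ suc d      ≡⟨ frac-suc a d ⟩
  ℤ.+ suc a ℚ./ suc d              ∎
  where
  open ≡-Reasoning
  open +-*-Solver

1≤multiple : ∀ x → 0ℚ ℚ.< x → ∃ λ N → 1ℚ ℚ.≤ ι N ℚ.* x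
1≤multiple x 0<x with archimedean x 0<x
... | N , h = suc N , (begin
  1ℚ                      ≤⟨ frac-mono 1 0 (suc N) N (ℕₚ.≤-reflexive (ℕₚ.*-comm 1 (suc N))) ⟩
  ℤ.+ suc N ℚ./ suc N     ≡⟨ ι-/ (suc N) N ⟨
  ι (suc N) ℚ.* 1/suc N   ≤⟨ ℚₚ.*-monoˡ-≤-nonNeg (ι (suc N)) {{ℚ.nonNegative (0≤ι (suc N))}} h ⟩
  ι (suc N) ℚ.* x         ∎)
  where open ℚₚ.≤-Reasoning

-- Walk down from N until the next lower multiple would drop below A; the overshoot is then at most
-- one step x.
multiple-between : ∀ A x → 0ℚ ℚ.≤ A → 0ℚ ℚ.≤ x → ∀ N → A ℚ.≤ ι N ℚ.* x →
  ∃ λ d → A ℚ.≤ ι d ℚ.* x × ι d ℚ.* x ℚ.≤ A ℚ.+ x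
multiple-between A x 0≤A 0≤x zero    h = 0 , h ,
  ℚₚ.≤-trans (ℚₚ.≤-reflexive (ℚₚ.*-zeroˡ x)) (+-nonNeg 0≤A 0≤x)
multiple-between A x 0≤A 0≤x (suc N) h with A ℚₚ.≤? ι N ℚ.* x
... | yes h′ = multiple-between A x 0≤A 0≤x N h′
... | no ¬h  = suc N , h , (begin
  ι (suc N) ℚ.* x        ≡⟨ cong (ℚ._* x) (ι-suc N) ⟩
  (1ℚ ℚ.+ ι N) ℚ.* x     ≡⟨ solve 2 (λ a b → (con 1ℚ :+ a) :* b := a :* b :+ b) refl (ι N) x ⟩
  ι N ℚ.* x ℚ.+ x        ≤⟨ ℚₚ.+-monoˡ-≤ x (ℚₚ.<⇒≤ (ℚₚ.≰⇒> ¬h)) ⟩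
  A ℚ.+ x                ∎)
  where
  open ℚₚ.≤-Reasoning
  open +-*-Solver

-- A division-free form of (1-x)^d ≤ 1/(1+dx). The induction uses (1-x)(1+(d+1)x) = 1 + dx -
-- (d+1)x².
bernoulli : ∀ {x} d → 0ℚ ℚ.≤ x → x ℚ.≤ 1ℚ → (1ℚ ℚ.- x) ^ d ℚ.* (1ℚ ℚ.+ ι d ℚ.* x) ℚ.≤ 1ℚ
bernoulli {x} zero    0≤x x≤1 = ℚₚ.≤-reflexive
  (solve 1 (λ x → con 1ℚ :* (con 1ℚ :+ con 0ℚ :* x) := con 1ℚ) refl x)
  where open +-*-Solver
bernoulli {x} (suc d) 0≤x x≤1 = ℚₚ.≤-trans
  (≤-by ((1ℚ ℚ.- x) ^ d ℚ.* (ι (suc d) ℚ.* (x ℚ.* x)))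
    (*-nonNeg (^-nonNeg d (0≤b-a x≤1)) (*-nonNeg (0≤ι (suc d)) (*-nonNeg 0≤x 0≤x)))
    (trans (cong (λ D → (1ℚ ℚ.- x) ^ suc d ℚ.* (1ℚ ℚ.+ D ℚ.* x) ℚ.+ (1ℚ ℚ.- x) ^ d ℚ.* (D ℚ.* (x ℚ.* x)))
             (ι-suc d))
      (solve 3 (λ x D P →
          (con 1ℚ :- x) :* P :* (con 1ℚ :+ (con 1ℚ :+ D) :* x) :+ P :* ((con 1ℚ :+ D) :* (x :* x))
            := P :* (con 1ℚ :+ D :* x)) refl x (ι d) ((1ℚ ℚ.- x) ^ d))))
  (bernoulli d 0≤x x≤1)
  where open +-*-Solver

reciprocals-nonNeg : ∀ a l → 0ℚ ℚ.≤ reciprocals a l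
reciprocals-nonNeg a zero    = ℚₚ.≤-refl
reciprocals-nonNeg a (suc l) = +-nonNeg (ℚₚ.<⇒≤ (1/suc-pos a)) (reciprocals-nonNeg (suc a) l)

-- Oresme's grouping: the 2^i reciprocals from 1/(2^i+1) to 1/2^(i+1) add up to at least ½, so every
-- doubling contributes ½. This plays the part of log 2 ≥ 1/2.
reciprocals-dyadic : ∀ j r → 2 ℕ.^ j ℕ.≤ suc r → ι j ℚ.* ℚ.½ ℚ.≤ reciprocals 1 r
reciprocals-dyadic zero    r h = ℚₚ.≤-trans (ℚₚ.≤-reflexive (ℚₚ.*-zeroˡ ℚ.½)) (reciprocals-nonNeg 1 r)
reciprocals-dyadic (suc j) r h
  with 2 ℕ.^ j | reciprocals-dyadic j | ℕₚ.m^n>0 2 j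
... | suc k | rec | _ with ℕₚ.m≤n⇒∃[o]m+o≡n h
... | e , eq = begin
  ι (suc j) ℚ.* ℚ.½                            ≡⟨ cong (ℚ._* ℚ.½) (ι-suc j) ⟩
  (1ℚ ℚ.+ ι j) ℚ.* ℚ.½
    ≡⟨ solve 1 (λ a → (con 1ℚ :+ a) :* con ℚ.½ := a :* con ℚ.½ :+ (con ℚ.½ :+ con 0ℚ)) refl (ι j) ⟩
  ι j ℚ.* ℚ.½ ℚ.+ (ℚ.½ ℚ.+ 0ℚ)
    ≤⟨ ℚₚ.+-mono-≤ (rec k ℕₚ.≤-refl) (ℚₚ.+-mono-≤ block (reciprocals-nonNeg (suc k ℕ.+ suc k) e)) ⟩
  reciprocals 1 k ℚ.+ (reciprocals (suc k) (suc k) ℚ.+ reciprocals (suc k ℕ.+ suc k) e)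
    ≡⟨ cong (reciprocals 1 k ℚ.+_) (reciprocals-+ (suc k) (suc k) e) ⟨
  reciprocals 1 k ℚ.+ reciprocals (suc k) (suc k ℕ.+ e)
    ≡⟨ reciprocals-+ 1 k (suc k ℕ.+ e) ⟨
  reciprocals 1 (k ℕ.+ (suc k ℕ.+ e))          ≡⟨ cong (reciprocals 1) r≡ ⟩
  reciprocals 1 r                              ∎
  where
  open ℚₚ.≤-Reasoning
  open +-*-Solver
  r≡ : k ℕ.+ (suc k ℕ.+ e) ≡ r
  r≡ = ℕₚ.suc-injective (trans (N.solve 2 (λ k e → N.con 1 N.:+ (k N.:+ (N.con 1 N.:+ k N.:+ e))
         N.:= (N.con 1 N.:+ k) N.:+ ((N.con 1 N.:+ k) N.:+ N.con 0) N.:+ e) refl k e) eq)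
    where module N = ℕ-Solver
  block : ℚ.½ ℚ.≤ reciprocals (suc k) (suc k)
  block = ℚₚ.≤-trans
    (frac-mono 1 1 (suc k) (k ℕ.+ suc k) (ℕₚ.≤-reflexive
      (N.solve 1 (λ k → N.con 1 N.:* (N.con 1 N.:+ (k N.:+ (N.con 1 N.:+ k)))
        N.:= (N.con 1 N.:+ k) N.:* N.con 2) refl k)))
    (block-lower (suc k) (suc k) (k ℕ.+ suc k) ℕₚ.≤-refl)
    where module N = ℕ-Solver

-- Right-endpoint sums of the decreasing function 1/x can only grow under refinement, so the sum of
-- mesh 1 bounds every term of the sequence `log` from below.
log-lower : ∀ j r m → 2 ℕ.^ j ℕ.≤ suc r → ι j ℚ.* ℚ.½ ℚ.≤ seq (log (suc r)) m
log-lower j r m h = ℚₚ.≤-trans (reciprocals-dyadic j r h)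
  (subst (λ a → reciprocals 1 r ℚ.≤ reciprocals a (r ℕ.* suc m)) (ℕₚ.*-identityˡ (suc m))
    (refine-lower 1 r m))

dyadic-scale : ∀ n → 1 ℕ.≤ n → ∃ λ j → 2 ℕ.^ j ℕ.≤ n × n ℕ.< 2 ℕ.^ suc j
dyadic-scale (suc zero)    _ = 0 , ℕₚ.≤-refl , ℕₚ.≤-refl
dyadic-scale (suc (suc n)) _ with dyadic-scale (suc n) (ℕ.s≤s ℕ.z≤n)
... | j , lo , hi with suc (suc n) ℕ.<? 2 ℕ.^ suc j
... | yes lt = j , ℕₚ.m≤n⇒m≤1+n lo , lt
... | no ¬lt = suc j , ℕₚ.≮⇒≥ ¬lt , ℕₚ.≤-<-trans hi
  (ℕₚ.^-monoʳ-< 2 (ℕ.s≤s (ℕ.s≤s ℕ.z≤n)) (ℕₚ.n<1+n (suc j)))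

-- The factor 2 covers j = 3, where j² exceeds 2^j. From 3 on, (j+1)² ≤ 2j².
square≤2^ : ∀ j → j ℕ.* j ℕ.≤ 2 ℕ.* 2 ℕ.^ j
square≤2^ 0 = ℕ.z≤n
square≤2^ 1 = toWitness {a? = 1 ℕ.≤? 4} tt
square≤2^ 2 = toWitness {a? = 4 ℕ.≤? 8} tt
square≤2^ 3 = toWitness {a? = 9 ℕ.≤? 16} tt
square≤2^ (suc j₃@(suc (suc (suc j)))) = begin
  (4 ℕ.+ j) ℕ.* (4 ℕ.+ j)
    ≤⟨ ℕₚ.m≤m+n _ (2 ℕ.+ j ℕ.* (4 ℕ.+ j)) ⟩
  (4 ℕ.+ j) ℕ.* (4 ℕ.+ j) ℕ.+ (2 ℕ.+ j ℕ.* (4 ℕ.+ j))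
    ≡⟨ solve 1 (λ j → (con 4 :+ j) :* (con 4 :+ j) :+ (con 2 :+ j :* (con 4 :+ j))
         := con 2 :* ((con 3 :+ j) :* (con 3 :+ j))) refl j ⟩
  2 ℕ.* ((3 ℕ.+ j) ℕ.* (3 ℕ.+ j))
    ≤⟨ ℕₚ.*-monoʳ-≤ 2 (square≤2^ j₃) ⟩
  2 ℕ.* (2 ℕ.* 2 ℕ.^ (3 ℕ.+ j))  ∎
  where
  open ℕₚ.≤-Reasoning
  open ℕ-Solver

-- The union bound is small

*-monoˡ : ∀ {a b c} → 0ℚ ℚ.≤ a → b ℚ.≤ c → a ℚ.* b ℚ.≤ a ℚ.* c
*-monoˡ {a} 0≤a = ℚₚ.*-monoˡ-≤-nonNeg a {{ℚ.nonNegative 0≤a}}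

*-monoʳ : ∀ {a b c} → 0ℚ ℚ.≤ a → b ℚ.≤ c → b ℚ.* a ℚ.≤ c ℚ.* a
*-monoʳ {a} 0≤a = ℚₚ.*-monoʳ-≤-nonNeg a {{ℚ.nonNegative 0≤a}}

2^*½^ : ∀ n → 2ℚ ^ n ℚ.* ℚ.½ ^ n ≡ 1ℚ
2^*½^ zero    = refl
2^*½^ (suc n) = trans
  (solve 2 (λ a b → con 2ℚ :* a :* (con ℚ.½ :* b) := a :* b) refl (2ℚ ^ n) (ℚ.½ ^ n))
  (2^*½^ n)
  where open +-*-Solver

-- The union bound ranges over n² < 4·4^J pairs, so a rate below 1/4 per binary digit is required; 4
-- · 1/5 = 4/5 is the resulting decay.
⅕ ⅘ : ℚ
⅕ = ℤ.+ 1 ℚ./ 5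
⅘ = 1ℚ ℚ.- ⅕

0≤⅕ : 0ℚ ℚ.≤ ⅕
0≤⅕ = toWitness {a? = 0ℚ ℚₚ.≤? ⅕} tt

⅕≤1 : ⅕ ℚ.≤ 1ℚ
⅕≤1 = toWitness {a? = ⅕ ℚₚ.≤? 1ℚ} tt

4^*⅕^ : ∀ n → 2ℚ ^ n ℚ.* (2ℚ ^ n ℚ.* ⅕ ^ n) ≡ ⅘ ^ n
4^*⅕^ zero    = refl
4^*⅕^ (suc n) = trans
  (solve 2 (λ a b → con 2ℚ :* a :* (con 2ℚ :* a :* (con ⅕ :* b)) := con ⅘ :* (a :* (a :* b)))
    refl (2ℚ ^ n) (⅕ ^ n))
  (cong (⅘ ℚ.*_) (4^*⅕^ n))
  where open +-*-Solver

-- By `bernoulli`, (4/5)^J (1 + J/5) ≤ 1, so it is enough that J/5 ≥ C/δ; N is chosen for this.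
⅘^-small : ∀ C δ → 0ℚ ℚ.< C → 0ℚ ℚ.< δ → ∃ λ J₀ → ∀ J → J₀ ℕ.≤ J → C ℚ.* ⅘ ^ J ℚ.≤ δ
⅘^-small C δ 0<C 0<δ = proj₁ multiple , λ J N≤J → begin
  C ℚ.* ⅘ ^ J                              ≡⟨ ℚₚ.*-identityʳ (C ℚ.* ⅘ ^ J) ⟨
  C ℚ.* ⅘ ^ J ℚ.* 1ℚ                       ≤⟨ *-monoˡ (*-nonNeg (ℚₚ.<⇒≤ 0<C) (0≤⅘^ J)) (proj₂ multiple) ⟩
  C ℚ.* ⅘ ^ J ℚ.* (ι N ℚ.* (⅕ ℚ.* (i ℚ.* δ)))
    ≡⟨ solve 6 (λ C y N f i δ → C :* y :* (N :* (f :* (i :* δ))) := y :* (N :* f) :* ((C :* i) :* δ))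
         refl C (⅘ ^ J) (ι N) ⅕ i δ ⟩
  ⅘ ^ J ℚ.* (ι N ℚ.* ⅕) ℚ.* ((C ℚ.* i) ℚ.* δ)
    ≡⟨ cong (⅘ ^ J ℚ.* (ι N ℚ.* ⅕) ℚ.*_) (trans (cong (ℚ._* δ) (inv-r C 0<C)) (ℚₚ.*-identityˡ δ)) ⟩
  ⅘ ^ J ℚ.* (ι N ℚ.* ⅕) ℚ.* δ
    ≤⟨ *-monoʳ (ℚₚ.<⇒≤ 0<δ) (*-monoˡ (0≤⅘^ J) (ℚₚ.≤-trans
         (*-monoʳ 0≤⅕ (ι-mono {N} {J} N≤J)) (≤-by 1ℚ 0≤1ℚ (ℚₚ.+-comm (ι J ℚ.* ⅕) 1ℚ)))) ⟩
  ⅘ ^ J ℚ.* (1ℚ ℚ.+ ι J ℚ.* ⅕) ℚ.* δ       ≤⟨ *-monoʳ (ℚₚ.<⇒≤ 0<δ) (bernoulli J 0≤⅕ ⅕≤1) ⟩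
  1ℚ ℚ.* δ                                 ≡⟨ ℚₚ.*-identityˡ δ ⟩
  δ                                        ∎
  where
  open ℚₚ.≤-Reasoning
  open +-*-Solver
  i : ℚ
  i = inv C 0<C
  multiple : ∃ λ N → 1ℚ ℚ.≤ ι N ℚ.* (⅕ ℚ.* (i ℚ.* δ))
  multiple = 1≤multiple (⅕ ℚ.* (i ℚ.* δ)) (*-pos (ℚₚ.positive⁻¹ ⅕) (*-pos (inv-pos C 0<C) 0<δ))
  N : ℕ
  N = proj₁ multiple
  0≤⅘^ : ∀ J → 0ℚ ℚ.≤ ⅘ ^ J
  0≤⅘^ J = ^-nonNeg J (0≤b-a ⅕≤1)

module _ (p : ℚ) (0≤p : 0ℚ ℚ.≤ p) (p≤1 : p ℚ.≤ 1ℚ) where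
  open Confusion p 0≤p p≤1

  s≤1 : s ℚ.≤ 1ℚ
  s≤1 = ℚₚ.≤-trans s≤1/16 (toWitness {a? = (ℤ.+ 1 ℚ./ 16) ℚₚ.≤? 1ℚ} tt)

  -- α ≤ (1 - s)², and (1 - s)^d ≤ 1/(1 + ds) ≤ 4/9.
  α^d≤⅕ : ∀ d → ℤ.+ 5 ℚ./ 4 ℚ.≤ ι d ℚ.* s → α ^ d ℚ.≤ ⅕
  α^d≤⅕ d 5/4≤ds = begin
    α ^ d                                ≤⟨ ^-mono d 0≤α α≤square ⟩
    ((1ℚ ℚ.- s) ℚ.* (1ℚ ℚ.- s)) ^ d      ≡⟨ square^ d ⟩
    u ℚ.* u                              ≤⟨ *-mono (ℚₚ.≤-trans 0≤u u≤4/9) 0≤u u≤4/9 u≤4/9 ⟩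
    (ℤ.+ 4 ℚ./ 9) ℚ.* (ℤ.+ 4 ℚ./ 9)      ≤⟨ toWitness {a? = ((ℤ.+ 4 ℚ./ 9) ℚ.* (ℤ.+ 4 ℚ./ 9)) ℚₚ.≤? ⅕} tt ⟩
    ⅕                                    ∎
    where
    open ℚₚ.≤-Reasoning
    open +-*-Solver
    u : ℚ
    u = (1ℚ ℚ.- s) ^ d
    0≤u : 0ℚ ℚ.≤ u
    0≤u = ^-nonNeg d (0≤b-a s≤1)
    -- Bernoulli applied to α itself would only give 1/(1 + 5/2) = 2/7, above the critical 1/4.
    -- Applied to 1 - s it gives 4/9, and the square 16/81 is below 1/5.
    α≤square : α ℚ.≤ (1ℚ ℚ.- s) ℚ.* (1ℚ ℚ.- s)
    α≤square = ≤-by (s ℚ.* s) (*-nonNeg 0≤s 0≤s)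
      (solve 1 (λ s → con 1ℚ :- con 2ℚ :* s :+ s :* s := (con 1ℚ :- s) :* (con 1ℚ :- s)) refl s)
    square^ : ∀ {a} d → (a ℚ.* a) ^ d ≡ a ^ d ℚ.* a ^ d
    square^ zero    = refl
    square^ {a} (suc d) = trans (cong (a ℚ.* a ℚ.*_) (square^ d))
      (solve 2 (λ a b → a :* a :* (b :* b) := a :* b :* (a :* b)) refl a (a ^ d))
    u≤4/9 : u ℚ.≤ ℤ.+ 4 ℚ./ 9
    u≤4/9 = begin
      u                                           ≡⟨ solve 1 (λ u → u := u :* con (ℤ.+ 9 ℚ./ 4) :* con (ℤ.+ 4 ℚ./ 9)) refl u ⟩
      u ℚ.* (1ℚ ℚ.+ ℤ.+ 5 ℚ./ 4) ℚ.* (ℤ.+ 4 ℚ./ 9)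
        ≤⟨ *-monoʳ (0≤4/9) (*-monoˡ 0≤u (ℚₚ.+-monoʳ-≤ 1ℚ 5/4≤ds)) ⟩
      u ℚ.* (1ℚ ℚ.+ ι d ℚ.* s) ℚ.* (ℤ.+ 4 ℚ./ 9)  ≤⟨ *-monoʳ 0≤4/9 (bernoulli d 0≤s s≤1) ⟩
      1ℚ ℚ.* (ℤ.+ 4 ℚ./ 9)                        ≡⟨⟩
      ℤ.+ 4 ℚ./ 9                                 ∎
      where
      0≤4/9 : 0ℚ ℚ.≤ ℤ.+ 4 ℚ./ 9
      0≤4/9 = toWitness {a? = 0ℚ ℚₚ.≤? (ℤ.+ 4 ℚ./ 9)} tt

  β^t≤½ : ∀ t → 1ℚ ℚ.≤ ι t ℚ.* (ℚ.½ ℚ.* p) → β ^ t ℚ.≤ ℚ.½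
  β^t≤½ t 1≤tp = begin
    β ^ t                          ≡⟨ solve 1 (λ u → u := u :* con 2ℚ :* con ℚ.½) refl (β ^ t) ⟩
    β ^ t ℚ.* (1ℚ ℚ.+ 1ℚ) ℚ.* ℚ.½  ≤⟨ *-monoʳ (ℚₚ.<⇒≤ ½>0) (*-monoˡ (^-nonNeg t 0≤β) (ℚₚ.+-monoʳ-≤ 1ℚ 1≤tp)) ⟩
    β ^ t ℚ.* (1ℚ ℚ.+ ι t ℚ.* (ℚ.½ ℚ.* p)) ℚ.* ℚ.½
      ≤⟨ *-monoʳ (ℚₚ.<⇒≤ ½>0) (bernoulli t (*-nonNeg (ℚₚ.<⇒≤ ½>0) 0≤p) ½p≤1) ⟩
    1ℚ ℚ.* ℚ.½                     ≡⟨⟩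
    ℚ.½                            ∎
    where
    open ℚₚ.≤-Reasoning
    open +-*-Solver
    ½p≤1 : ℚ.½ ℚ.* p ℚ.≤ 1ℚ
    ½p≤1 = ℚₚ.≤-trans (*-monoˡ (ℚₚ.<⇒≤ ½>0) p≤1) (toWitness {a? = (ℚ.½ ℚ.* 1ℚ) ℚₚ.≤? 1ℚ} tt)

  -- The constant is 36 = 2·2·(2²·2 + 1): two factors n ≤ 2·2^J, two possibly wasted pairs, one
  -- query lost to `pred`, and 1 for the event of too few edges.
  confusion-small : ∀ d t J n → ℤ.+ 5 ℚ./ 4 ℚ.≤ ι d ℚ.* s → 1ℚ ℚ.≤ ι t ℚ.* (ℚ.½ ℚ.* p) →
    n ℕ.< 2 ℕ.^ suc J →
    ι n ℚ.* (ι n ℚ.* confusion-bound 2 (ℕ.pred (d ℕ.* J)) (t ℕ.* ((d ℕ.+ 3) ℕ.* J)))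
      ℚ.≤ ι 36 ℚ.* ⅘ ^ J
  confusion-small d t J n 5/4≤ds 1≤tp n<2^ = begin
    ι n ℚ.* (ι n ℚ.* confusion-bound 2 b M)
      ≤⟨ *-mono 0≤2^J (*-nonNeg (0≤ι n) 0≤bound) n≤
           (*-mono 0≤2^J 0≤bound n≤ (ℚₚ.+-mono-≤ (*-monoˡ (^-nonNeg 2 0≤2ℚ) edges-small) pairs-small)) ⟩
    (2ℚ ℚ.* 2ℚ ^ J) ℚ.* ((2ℚ ℚ.* 2ℚ ^ J) ℚ.* (2ℚ ^ 2 ℚ.* (2ℚ ℚ.* ⅕ ^ J) ℚ.+ ⅕ ^ J))
      ≡⟨ solve 2 (λ a f → con 2ℚ :* a :* (con 2ℚ :* a :* (con (2ℚ ^ 2) :* (con 2ℚ :* f) :+ f))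
           := con (ι 36) :* (a :* (a :* f))) refl (2ℚ ^ J) (⅕ ^ J) ⟩
    ι 36 ℚ.* (2ℚ ^ J ℚ.* (2ℚ ^ J ℚ.* ⅕ ^ J))
      ≡⟨ cong (ι 36 ℚ.*_) (4^*⅕^ J) ⟩
    ι 36 ℚ.* ⅘ ^ J ∎
    where
    open ℚₚ.≤-Reasoning
    open +-*-Solver
    b M : ℕ
    b = ℕ.pred (d ℕ.* J)
    -- Every t pairs contribute a factor at most ½. Of the (d+3)J halvings, dJ cancel 2^b and the
    -- other 3J leave (1/8)^J ≤ (1/5)^J.
    M = t ℕ.* ((d ℕ.+ 3) ℕ.* J)
    0≤2^J : 0ℚ ℚ.≤ 2ℚ ℚ.* 2ℚ ^ J
    0≤2^J = *-nonNeg 0≤2ℚ (^-nonNeg J 0≤2ℚ)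
    0≤bound : 0ℚ ℚ.≤ confusion-bound 2 b M
    0≤bound = +-nonNeg (*-nonNeg (^-nonNeg 2 0≤2ℚ) (^-nonNeg b 0≤α))
                       (*-nonNeg (^-nonNeg b 0≤2ℚ) (^-nonNeg M 0≤β))
    n≤ : ι n ℚ.≤ 2ℚ ℚ.* 2ℚ ^ J
    n≤ = ℚₚ.≤-trans (ι-mono (ℕₚ.<⇒≤ n<2^)) (ℚₚ.≤-reflexive (ι-2^ (suc J)))
    α^pred : ∀ m → α ^ ℕ.pred m ℚ.≤ 2ℚ ℚ.* α ^ m
    α^pred zero    = 1≤2ℚ
    α^pred (suc m) = begin
      α ^ m                       ≡⟨ solve 1 (λ a → a := con 2ℚ :* (con ℚ.½ :* a)) refl (α ^ m) ⟩
      2ℚ ℚ.* (ℚ.½ ℚ.* α ^ m)      ≤⟨ *-monoˡ 0≤2ℚ (*-monoʳ (^-nonNeg m 0≤α) ½≤α) ⟩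
      2ℚ ℚ.* (α ℚ.* α ^ m)        ∎
    2^pred : ∀ m → 2ℚ ^ ℕ.pred m ℚ.≤ 2ℚ ^ m
    2^pred zero    = ℚₚ.≤-refl
    2^pred (suc m) = ℚₚ.≤-trans (ℚₚ.≤-reflexive (sym (ℚₚ.*-identityˡ (2ℚ ^ m))))
      (*-monoʳ (^-nonNeg m 0≤2ℚ) 1≤2ℚ)
    edges-small : α ^ b ℚ.≤ 2ℚ ℚ.* ⅕ ^ J
    edges-small = ℚₚ.≤-trans (α^pred (d ℕ.* J)) (*-monoˡ 0≤2ℚ
      (ℚₚ.≤-trans (ℚₚ.≤-reflexive (sym (^-assocʳ α d J)))
        (^-mono J (^-nonNeg d 0≤α) (α^d≤⅕ d 5/4≤ds))))
    pairs-small : 2ℚ ^ b ℚ.* β ^ M ℚ.≤ ⅕ ^ J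
    pairs-small = begin
      2ℚ ^ b ℚ.* β ^ M
        ≤⟨ *-mono (^-nonNeg (d ℕ.* J) 0≤2ℚ) (^-nonNeg M 0≤β) (2^pred (d ℕ.* J))
             (ℚₚ.≤-trans (ℚₚ.≤-reflexive (sym (^-assocʳ β t ((d ℕ.+ 3) ℕ.* J))))
               (^-mono ((d ℕ.+ 3) ℕ.* J) (^-nonNeg t 0≤β) (β^t≤½ t 1≤tp))) ⟩
      2ℚ ^ (d ℕ.* J) ℚ.* ℚ.½ ^ ((d ℕ.+ 3) ℕ.* J)
        ≡⟨ cong (2ℚ ^ (d ℕ.* J) ℚ.*_)
             (trans (cong (ℚ.½ ^_) (ℕₚ.*-distribʳ-+ J d 3)) (^-homo-* ℚ.½ (d ℕ.* J) (3 ℕ.* J))) ⟩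
      2ℚ ^ (d ℕ.* J) ℚ.* (ℚ.½ ^ (d ℕ.* J) ℚ.* ℚ.½ ^ (3 ℕ.* J))
        ≡⟨ ℚₚ.*-assoc (2ℚ ^ (d ℕ.* J)) _ _ ⟨
      2ℚ ^ (d ℕ.* J) ℚ.* ℚ.½ ^ (d ℕ.* J) ℚ.* ℚ.½ ^ (3 ℕ.* J)
        ≡⟨ cong (ℚ._* ℚ.½ ^ (3 ℕ.* J)) (2^*½^ (d ℕ.* J)) ⟩
      1ℚ ℚ.* ℚ.½ ^ (3 ℕ.* J)     ≡⟨ ℚₚ.*-identityˡ _ ⟩
      ℚ.½ ^ (3 ℕ.* J)            ≡⟨ ^-assocʳ ℚ.½ 3 J ⟨
      (ℚ.½ ^ 3) ^ J              ≤⟨ ^-mono J (^-nonNeg 3 (ℚₚ.<⇒≤ ½>0)) (toWitness {a? = (ℚ.½ ^ 3) ℚₚ.≤? ⅕} tt) ⟩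
      ⅕ ^ J                      ∎

-- Passing to the real parameter p

a≤∣a∣ : ∀ a → a ℚ.≤ ℚ.∣ a ∣
a≤∣a∣ a with ℚₚ.≤-total 0ℚ a
... | inj₁ 0≤a = ℚₚ.≤-reflexive (sym (ℚₚ.0≤p⇒∣p∣≡p 0≤a))
... | inj₂ a≤0 = ℚₚ.≤-trans a≤0 (ℚₚ.0≤∣p∣ a)

∣a-b∣≤⇒a≤c+b : ∀ {a b c} → ℚ.∣ a ℚ.- b ∣ ℚ.≤ c → a ℚ.≤ c ℚ.+ b
∣a-b∣≤⇒a≤c+b {a} {b} h = ≤-shift (ℚₚ.≤-trans (a≤∣a∣ (a ℚ.- b)) h)

clear-inverse : ∀ {a} (0<a : 0ℚ ℚ.< a) {L K} → ι 3 ℚ.* inv a 0<a ℚ.* L ℚ.≤ K → ι 3 ℚ.* L ℚ.≤ K ℚ.* a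
clear-inverse {a} 0<a {L} {K} h = begin
  ι 3 ℚ.* L                            ≡⟨ ℚₚ.*-identityʳ _ ⟨
  ι 3 ℚ.* L ℚ.* 1ℚ                     ≡⟨ cong (ι 3 ℚ.* L ℚ.*_) (inv-r a 0<a) ⟨
  ι 3 ℚ.* L ℚ.* (a ℚ.* inv a 0<a)
    ≡⟨ solve 4 (λ t L a i → t :* L :* (a :* i) := t :* i :* L :* a) refl (ι 3) L a (inv a 0<a) ⟩
  ι 3 ℚ.* inv a 0<a ℚ.* L ℚ.* a        ≤⟨ *-monoʳ (ℚₚ.<⇒≤ 0<a) h ⟩
  K ℚ.* a                              ∎
  where
  open ℚₚ.≤-Reasoning
  open +-*-Solver

module _ (p : ℝ) (0<p : 0ℝ < p) (p<1 : p < 1ℝ) where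

  p²q² : ℝ
  p²q² = (p * p) * ((1ℝ - p) * (1ℝ - p))

  0<p²q² : 0ℝ < p²q²
  0<p²q² = 0<x*y {p * p} {(1ℝ - p) * (1ℝ - p)} (0<x*y {p} {p} 0<p 0<p)
    (0<x*y {1ℝ - p} {1ℝ - p} (x<y⇒0<y-x {p} {1ℝ} p<1) (x<y⇒0<y-x {p} {1ℝ} p<1))

  clamp : ℚ
  clamp = proj₁ 0<p²q²

  -- The rate of d queries per binary digit of n is affordable, as d ≤ 3/(2s) ≤ 3/s · log 2, and
  -- sufficient, as d ≥ 5/(4s) gives (1-2s)^d ≤ 1/5.
  record Calibrated (d t m : ℕ) : Set where
    field
      0≤p     : 0ℚ ℚ.≤ seq p m
      p≤1     : seq p m ℚ.≤ 1ℚ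
      5/4≤ds  : ℤ.+ 5 ℚ./ 4 ℚ.≤ ι d ℚ.* seq p²q² m
      -- The clamped term is the one that `recip` inverts in `bound`.
      ds≤3/2  : ι d ℚ.* (seq p²q² m ℚ.⊔ clamp) ℚ.≤ ℤ.+ 3 ℚ./ 2
      1≤tp    : 1ℚ ℚ.≤ ι t ℚ.* (ℚ.½ ℚ.* seq p m)

  -- d is fitted to the single term s at `M₀`, with 4/3 ≤ ds ≤ 4/3 + 1/16. Later terms differ from s
  -- by at most s/20, and 4/3 · 19/20 ≥ 5/4 while (4/3 + 1/16) · 21/20 ≤ 3/2, so the same d works
  -- for all of them.
  calibration : ∃₂ λ d t → Eventually (Calibrated d t)
  calibration = d , t , M₀ , λ m M₀≤m → record
    { 0≤p = 0≤p m (⊔-l {N₁} (⊔-l {N₁ ℕ.⊔ N₂} M₀≤m))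
    ; p≤1 = p≤1 m (⊔-r {N₁} (⊔-l {N₁ ℕ.⊔ N₂} M₀≤m))
    ; 5/4≤ds = begin
        ℤ.+ 5 ℚ./ 4     ≤⟨ toWitness {a? = (ℤ.+ 5 ℚ./ 4) ℚₚ.≤? ((ℤ.+ 4 ℚ./ 3) ℚ.* (ℤ.+ 19 ℚ./ 20))} tt ⟩
        (ℤ.+ 4 ℚ./ 3) ℚ.* (ℤ.+ 19 ℚ./ 20)  ≤⟨ *-monoʳ 0≤19/20 4/3≤ds ⟩
        ι d ℚ.* s ℚ.* (ℤ.+ 19 ℚ./ 20)
          ≡⟨ solve 2 (λ d s → d :* s :* con (ℤ.+ 19 ℚ./ 20) := d :* (s :- con (ℤ.+ 1 ℚ./ 20) :* s)) refl (ι d) s ⟩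
        ι d ℚ.* (s ℚ.- (ℤ.+ 1 ℚ./ 20) ℚ.* s)
          ≤⟨ *-monoˡ (0≤ι d) (≤-unshift {s} {(ℤ.+ 1 ℚ./ 20) ℚ.* s} (ℚₚ.≤-trans (near-s M₀ m ℕₚ.≤-refl M₀≤m)
               (ℚₚ.≤-reflexive (ℚₚ.+-comm ((ℤ.+ 1 ℚ./ 20) ℚ.* s) (seq p²q² m))))) ⟩
        ι d ℚ.* seq p²q² m ∎
    ; ds≤3/2 = begin
        ι d ℚ.* (seq p²q² m ℚ.⊔ clamp)
          ≡⟨ cong (ι d ℚ.*_) (ℚₚ.p≥q⇒p⊔q≡p (c≤ m (⊔-l {N₃} (⊔-r {N₁ ℕ.⊔ N₂} M₀≤m)))) ⟩
        ι d ℚ.* seq p²q² m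
          ≤⟨ *-monoˡ (0≤ι d) (near-s m M₀ M₀≤m ℕₚ.≤-refl) ⟩
        ι d ℚ.* ((ℤ.+ 1 ℚ./ 20) ℚ.* s ℚ.+ s)
          ≡⟨ solve 2 (λ d s → d :* (con (ℤ.+ 1 ℚ./ 20) :* s :+ s) := d :* s :* con (ℤ.+ 21 ℚ./ 20)) refl (ι d) s ⟩
        ι d ℚ.* s ℚ.* (ℤ.+ 21 ℚ./ 20)
          ≤⟨ *-monoʳ 0≤21/20 (ℚₚ.≤-trans ds≤ (ℚₚ.+-monoʳ-≤ (ℤ.+ 4 ℚ./ 3) s≤1/16)) ⟩
        (ℤ.+ 4 ℚ./ 3 ℚ.+ ℤ.+ 1 ℚ./ 16) ℚ.* (ℤ.+ 21 ℚ./ 20)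
          ≤⟨ toWitness {a? = ((ℤ.+ 4 ℚ./ 3 ℚ.+ ℤ.+ 1 ℚ./ 16) ℚ.* (ℤ.+ 21 ℚ./ 20)) ℚₚ.≤? (ℤ.+ 3 ℚ./ 2)} tt ⟩
        ℤ.+ 3 ℚ./ 2 ∎
    ; 1≤tp = ℚₚ.≤-trans 1≤te (*-monoˡ (0≤ι t) (*-monoˡ (ℚₚ.<⇒≤ ½>0) (e≤ m (⊔-l {N₁} (⊔-l {N₁ ℕ.⊔ N₂} M₀≤m)))))
    }
    where
    open ℚₚ.≤-Reasoning
    open +-*-Solver
    e e′ c : ℚ
    e  = proj₁ 0<p
    e′ = proj₁ p<1
    c  = clamp
    0<e : 0ℚ ℚ.< e
    0<e = proj₁ (proj₂ 0<p)
    0<e′ : 0ℚ ℚ.< e′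
    0<e′ = proj₁ (proj₂ p<1)
    0<c : 0ℚ ℚ.< c
    0<c = proj₁ (proj₂ 0<p²q²)
    close : ∃ λ N → ∀ m n → N ℕ.≤ m → N ℕ.≤ n →
            ℚ.∣ seq p²q² m ℚ.- seq p²q² n ∣ ℚ.≤ (ℤ.+ 1 ℚ./ 20) ℚ.* c
    close = cauchy p²q² ((ℤ.+ 1 ℚ./ 20) ℚ.* c) (*-pos (ℚₚ.positive⁻¹ (ℤ.+ 1 ℚ./ 20)) 0<c)
    N₁ N₂ N₃ N₄ t : ℕ
    N₁ = proj₁ (proj₂ (proj₂ 0<p))
    N₂ = proj₁ (proj₂ (proj₂ p<1))
    N₃ = proj₁ (proj₂ (proj₂ 0<p²q²))
    N₄ = proj₁ close
    t  = proj₁ (1≤multiple (ℚ.½ ℚ.* e) (*-pos ½>0 0<e))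
    1≤te : 1ℚ ℚ.≤ ι t ℚ.* (ℚ.½ ℚ.* e)
    1≤te = proj₂ (1≤multiple (ℚ.½ ℚ.* e) (*-pos ½>0 0<e))
    M₀ : ℕ
    M₀ = (N₁ ℕ.⊔ N₂) ℕ.⊔ (N₃ ℕ.⊔ N₄)
    0≤19/20 : 0ℚ ℚ.≤ ℤ.+ 19 ℚ./ 20
    0≤19/20 = toWitness {a? = 0ℚ ℚₚ.≤? (ℤ.+ 19 ℚ./ 20)} tt
    0≤21/20 : 0ℚ ℚ.≤ ℤ.+ 21 ℚ./ 20
    0≤21/20 = toWitness {a? = 0ℚ ℚₚ.≤? (ℤ.+ 21 ℚ./ 20)} tt
    e≤ : ∀ m → N₁ ℕ.≤ m → e ℚ.≤ seq p m
    e≤ m N₁≤m = subst (ℚ._≤ seq p m) (ℚₚ.+-identityˡ e) (proj₂ (proj₂ (proj₂ 0<p)) m N₁≤m)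
    0≤p : ∀ m → N₁ ℕ.≤ m → 0ℚ ℚ.≤ seq p m
    0≤p m N₁≤m = ℚₚ.≤-trans (ℚₚ.<⇒≤ 0<e) (e≤ m N₁≤m)
    p≤1 : ∀ m → N₂ ℕ.≤ m → seq p m ℚ.≤ 1ℚ
    p≤1 m N₂≤m = ℚₚ.≤-trans (≤-by e′ (ℚₚ.<⇒≤ 0<e′) refl) (proj₂ (proj₂ (proj₂ p<1)) m N₂≤m)
    c≤ : ∀ m → N₃ ℕ.≤ m → c ℚ.≤ seq p²q² m
    c≤ m N₃≤m = subst (ℚ._≤ seq p²q² m) (ℚₚ.+-identityˡ c) (proj₂ (proj₂ (proj₂ 0<p²q²)) m N₃≤m)
    N₃≤M₀ : N₃ ℕ.≤ M₀
    N₃≤M₀ = ⊔-l {N₃} (⊔-r {N₁ ℕ.⊔ N₂} (ℕₚ.≤-refl {M₀}))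
    s : ℚ
    s = seq p²q² M₀
    near-s : ∀ m m′ → M₀ ℕ.≤ m → M₀ ℕ.≤ m′ → seq p²q² m ℚ.≤ (ℤ.+ 1 ℚ./ 20) ℚ.* s ℚ.+ seq p²q² m′
    near-s m m′ M₀≤m M₀≤m′ = ℚₚ.≤-trans
      (∣a-b∣≤⇒a≤c+b {seq p²q² m} {seq p²q² m′}
        (proj₂ close m m′ (⊔-r {N₃} (⊔-r {N₁ ℕ.⊔ N₂} M₀≤m)) (⊔-r {N₃} (⊔-r {N₁ ℕ.⊔ N₂} M₀≤m′))))
      (ℚₚ.+-monoˡ-≤ (seq p²q² m′)
        (*-monoˡ (ℚₚ.<⇒≤ (ℚₚ.positive⁻¹ (ℤ.+ 1 ℚ./ 20))) (c≤ M₀ N₃≤M₀)))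
    0<s : 0ℚ ℚ.< s
    0<s = ℚₚ.<-≤-trans 0<c (c≤ M₀ N₃≤M₀)
    s≤1/16 : s ℚ.≤ ℤ.+ 1 ℚ./ 16
    s≤1/16 = Confusion.s≤1/16 (seq p M₀)
      (0≤p M₀ (⊔-l {N₁} (⊔-l {N₁ ℕ.⊔ N₂} (ℕₚ.≤-refl {M₀}))))
      (p≤1 M₀ (⊔-r {N₁} (⊔-l {N₁ ℕ.⊔ N₂} (ℕₚ.≤-refl {M₀}))))
    overshoot : ∃ λ N → ℤ.+ 4 ℚ./ 3 ℚ.≤ ι N ℚ.* s
    overshoot = let N , 1≤Ns = 1≤multiple s 0<s in 2 ℕ.* N , (begin
      ℤ.+ 4 ℚ./ 3          ≤⟨ toWitness {a? = (ℤ.+ 4 ℚ./ 3) ℚₚ.≤? (ι 2 ℚ.* 1ℚ)} tt ⟩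
      ι 2 ℚ.* 1ℚ           ≤⟨ *-monoˡ (0≤ι 2) 1≤Ns ⟩
      ι 2 ℚ.* (ι N ℚ.* s)  ≡⟨ ℚₚ.*-assoc (ι 2) (ι N) s ⟨
      ι 2 ℚ.* ι N ℚ.* s    ≡⟨ cong (ℚ._* s) (ι-* 2 N) ⟨
      ι (2 ℕ.* N) ℚ.* s    ∎)
    multiple : ∃ λ d → ℤ.+ 4 ℚ./ 3 ℚ.≤ ι d ℚ.* s × ι d ℚ.* s ℚ.≤ ℤ.+ 4 ℚ./ 3 ℚ.+ s
    multiple = multiple-between (ℤ.+ 4 ℚ./ 3) s (toWitness {a? = 0ℚ ℚₚ.≤? (ℤ.+ 4 ℚ./ 3)} tt)
      (ℚₚ.<⇒≤ 0<s) (proj₁ overshoot) (proj₂ overshoot)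
    d : ℕ
    d = proj₁ multiple
    4/3≤ds : ℤ.+ 4 ℚ./ 3 ℚ.≤ ι d ℚ.* s
    4/3≤ds = proj₁ (proj₂ multiple)
    ds≤ : ι d ℚ.* s ℚ.≤ ℤ.+ 4 ℚ./ 3 ℚ.+ s
    ds≤ = proj₂ (proj₂ multiple)

-- Convergence of the probability to one

matching-room : ∀ d t J → 4 ℕ.* (t ℕ.* (d ℕ.+ 3)) ℕ.≤ J →
  t ℕ.* ((d ℕ.+ 3) ℕ.* J) ℕ.* 2 ℕ.≤ 2 ℕ.^ J
matching-room d t J 4c≤J = ℕₚ.*-cancelˡ-≤ 2 (begin
  2 ℕ.* (t ℕ.* ((d ℕ.+ 3) ℕ.* J) ℕ.* 2)
    ≡⟨ solve 3 (λ t d J → con 2 :* (t :* (d :* J) :* con 2) := con 4 :* (t :* d) :* J)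
         refl t (d ℕ.+ 3) J ⟩
  4 ℕ.* (t ℕ.* (d ℕ.+ 3)) ℕ.* J    ≤⟨ ℕₚ.*-monoˡ-≤ J 4c≤J ⟩
  J ℕ.* J                          ≤⟨ square≤2^ J ⟩
  2 ℕ.* 2 ℕ.^ J                    ∎)
  where
  open ℕₚ.≤-Reasoning
  open ℕ-Solver

-- The bound δ is the same for all admissible m, as the passage from the rational terms to the real
-- probability requires.
Pr-near-one : ∀ (P : ℝ) m d t J n {E : SimpleGraph n → Set} (E? : U.Decidable E) {δ} →
  0ℚ ℚ.≤ seq P m → seq P m ℚ.≤ 1ℚ →
  ℤ.+ 5 ℚ./ 4 ℚ.≤ ι d ℚ.* ((seq P m ℚ.* seq P m) ℚ.* ((1ℚ ℚ.- seq P m) ℚ.* (1ℚ ℚ.- seq P m))) →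
  1ℚ ℚ.≤ ι t ℚ.* (ℚ.½ ℚ.* seq P m) →
  1 ℕ.≤ n → t ℕ.* ((d ℕ.+ 3) ℕ.* J) ℕ.* 2 ℕ.≤ n → n ℕ.< 2 ℕ.^ suc J →
  (∀ G → LocatesWithin G (Adjacent G) (ℕ.pred (d ℕ.* J)) ⊤ → E G) →
  ι 36 ℚ.* ⅘ ^ J ℚ.≤ δ →
  ℚ.∣ seq (Pr P n E?) m ℚ.- 1ℚ ∣ ℚ.≤ δ
Pr-near-one P m d t J n E? {δ} 0≤p p≤1 5/4≤ds 1≤tp 1≤n fits n<2^ easy small =
  subst (λ x → ℚ.∣ x ℚ.- 1ℚ ∣ ℚ.≤ δ) (sym (seq-Pr P m n E?)) (∣a-b∣≤ {𝔼good} {1ℚ}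
    (≤-unshift {𝔼good} {1ℚ} {δ} (ℚₚ.≤-trans (𝔼-indicator≤1 n (λ c → does (E? (graph c))))
      (≤-by δ 0≤δ (ℚₚ.+-comm 1ℚ δ))))
    (≤-unshift {1ℚ} {𝔼good} {δ} (begin
      1ℚ
        ≤⟨ failure n L (matching-isMatching M n fits) b 1≤n E? easy ⟩
      𝔼good ℚ.+ ι n ℚ.* (ι n ℚ.* confusion-bound 2 b (length L))
        ≡⟨ cong (λ l → 𝔼good ℚ.+ ι n ℚ.* (ι n ℚ.* confusion-bound 2 b l)) (length-matching M n fits) ⟩
      𝔼good ℚ.+ ι n ℚ.* (ι n ℚ.* confusion-bound 2 b M)
        ≤⟨ ℚₚ.+-monoʳ-≤ 𝔼good (ℚₚ.≤-trans
             (confusion-small (seq P m) 0≤p p≤1 d t J n 5/4≤ds 1≤tp n<2^) small) ⟩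
      𝔼good ℚ.+ δ
        ≡⟨ ℚₚ.+-comm 𝔼good δ ⟩
      δ ℚ.+ 𝔼good ∎)))
  where
  open ℚₚ.≤-Reasoning
  open Expectation (seq P m)
  open Confusion (seq P m) 0≤p p≤1 using (confusion-bound)
  open Failure (seq P m) 0≤p p≤1
  M b : ℕ
  M = t ℕ.* ((d ℕ.+ 3) ℕ.* J)
  b = ℕ.pred (d ℕ.* J)
  L : List (Fin n × Fin n)
  L = matching M n fits
  𝔼good : ℚ
  𝔼good = 𝔼 n (λ c → indicator (does (E? (graph c))))
  0≤δ : 0ℚ ℚ.≤ δ
  0≤δ = ℚₚ.≤-trans (*-nonNeg (0≤ι 36) (^-nonNeg J (0≤b-a ⅕≤1))) small

module _ (p : ℝ) (0<p : 0ℝ < p) (p<1 : p < 1ℝ) where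

  -- Integers are compared, so one index m beyond both thresholds decides. With a the clamped term
  -- there, 3J/2 ≤ 3 log n ≤ (k+1)a and da ≤ 3/2 give dJ ≤ k+1; the unit lost to rounding is
  -- absorbed by `pred`.
  queries-suffice : ∀ {d t} → Eventually (Calibrated p 0<p p<1 d t) → ∀ r J k → 2 ℕ.^ J ℕ.≤ suc r →
    k IsRoundingOf bound p 0<p p<1 (suc r) → ℕ.pred (d ℕ.* J) ℕ.≤ k
  queries-suffice {d} {t} (M₀ , calibrated) r J k 2^J≤n (ε , 0<ε , N , close) =
    ℕₚ.pred-mono-≤ (ι-cancel {d ℕ.* J} {suc k} (ℚₚ.*-cancelʳ-≤-pos (ℤ.+ 3 ℚ./ 2) (begin
      ι (d ℕ.* J) ℚ.* (ℤ.+ 3 ℚ./ 2)       ≡⟨ cong (ℚ._* (ℤ.+ 3 ℚ./ 2)) (ι-* d J) ⟩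
      ι d ℚ.* ι J ℚ.* (ℤ.+ 3 ℚ./ 2)
        ≡⟨ solve 2 (λ d j → d :* j :* con (ℤ.+ 3 ℚ./ 2) := d :* (con (ι 3) :* (j :* con ℚ.½)))
             refl (ι d) (ι J) ⟩
      ι d ℚ.* (ι 3 ℚ.* (ι J ℚ.* ℚ.½))
        ≤⟨ *-monoˡ (0≤ι d) (*-monoˡ (0≤ι 3) (log-lower J r m 2^J≤n)) ⟩
      ι d ℚ.* (ι 3 ℚ.* seq (log (suc r)) m)
        ≤⟨ *-monoˡ (0≤ι d) (clear-inverse {a} 0<a {seq (log (suc r)) m} {ι (suc k)} bound≤) ⟩
      ι d ℚ.* (ι (suc k) ℚ.* a)
        ≡⟨ solve 3 (λ d k a → d :* (k :* a) := k :* (d :* a)) refl (ι d) (ι (suc k)) a ⟩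
      ι (suc k) ℚ.* (ι d ℚ.* a)
        ≤⟨ *-monoˡ (0≤ι (suc k)) (Calibrated.ds≤3/2 (calibrated m (⊔-r {N} (ℕₚ.≤-refl {m})))) ⟩
      ι (suc k) ℚ.* (ℤ.+ 3 ℚ./ 2)         ∎)))
    where
    open ℚₚ.≤-Reasoning
    open +-*-Solver
    m : ℕ
    m = N ℕ.⊔ M₀
    a : ℚ
    a = seq (p²q² p 0<p p<1) m ℚ.⊔ clamp p 0<p p<1
    0<a : 0ℚ ℚ.< a
    0<a = ℚₚ.<-≤-trans (proj₁ (proj₂ (0<p²q² p 0<p p<1))) (ℚₚ.p≤q⊔p (seq (p²q² p 0<p p<1) m) _)
    bound≤ : seq (bound p 0<p p<1 (suc r)) m ℚ.≤ ι (suc k)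
    bound≤ = ℚₚ.≤-trans
      (∣a-b∣≤⇒a≤c+b {seq (bound p 0<p p<1 (suc r)) m} {ι k} {1ℚ}
        (subst (ℚ._≤ 1ℚ) (∣∣-swap (ι k) (seq (bound p 0<p p<1 (suc r)) m))
          (ℚₚ.≤-trans (≤-by ε (ℚₚ.<⇒≤ 0<ε) refl) (close m (⊔-l {N} (ℕₚ.≤-refl {m}))))))
      (ℚₚ.≤-reflexive (sym (ι-suc k)))

  bound∈O : bound p 0<p p<1 ∈O log
  bound∈O = ∣ fromℕ 3 * recip (p²q² p 0<p p<1) (0<p²q² p 0<p p<1) ∣ , 0 , λ n _ ε 0<ε → 0 , λ m _ →
    ℚₚ.≤-trans
      (ℚₚ.≤-reflexive (ℚₚ.∣p*q∣≡∣p∣*∣q∣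
        (seq (fromℕ 3 * recip (p²q² p 0<p p<1) (0<p²q² p 0<p p<1)) m) (seq (log n) m)))
      (≤-by ε (ℚₚ.<⇒≤ 0<ε) refl)

  module _ (k : ℕ → ℕ) (rounding : ∀ n → k n IsRoundingOf bound p 0<p p<1 n)
           {d t M₀ J₀ : ℕ} {δ : ℚ}
           (calibrated : ∀ m → M₀ ℕ.≤ m → Calibrated p 0<p p<1 d t m)
           (small : ∀ J → J₀ ℕ.≤ J → ι 36 ℚ.* ⅘ ^ J ℚ.≤ δ) where

    -- The threshold for n is uniform in m. Its part `J₀` makes the error small, and its other part
    -- makes room for the matching.
    converges : ∀ n → 2 ℕ.^ (J₀ ℕ.⊔ 4 ℕ.* (t ℕ.* (d ℕ.+ 3))) ℕ.≤ n → ∀ m → M₀ ℕ.≤ m →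
      ℚ.∣ seq (Pr p n (pq≤eq≤? (k n))) m ℚ.- 1ℚ ∣ ℚ.≤ δ
    converges zero    2^J₁≤n = contradiction 2^J₁≤n (ℕₚ.<⇒≱ (ℕₚ.m^n>0 2 (J₀ ℕ.⊔ 4 ℕ.* (t ℕ.* (d ℕ.+ 3)))))
    converges (suc r) 2^J₁≤n m M₀≤m with dyadic-scale (suc r) (ℕ.s≤s ℕ.z≤n)
    ... | J , 2^J≤n , n<2^ = Pr-near-one p m d t J (suc r) (pq≤eq≤? (k (suc r)))
      0≤p p≤1 5/4≤ds 1≤tp (ℕ.s≤s ℕ.z≤n)
      (ℕₚ.≤-trans (matching-room d t J (⊔-r {J₀} J₁≤J)) 2^J≤n) n<2^
      (λ G h → pq≤eq≤-fromEdges G (k (suc r)) (locates-weaken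
        (queries-suffice (M₀ , calibrated) r J (k (suc r)) 2^J≤n (rounding (suc r))) h))
      (small J (⊔-l J₁≤J))
      where
      open Calibrated (calibrated m M₀≤m)
      J₁≤J : J₀ ℕ.⊔ 4 ℕ.* (t ℕ.* (d ℕ.+ 3)) ℕ.≤ J
      J₁≤J = ℕₚ.≮⇒≥ λ J<J₁ → ℕₚ.<⇒≱ n<2^ (ℕₚ.≤-trans (ℕₚ.^-monoʳ-≤ 2 J<J₁) 2^J₁≤n)

  locates-aas : ∀ (k : ℕ → ℕ) → (∀ n → k n IsRoundingOf bound p 0<p p<1 n) →
    AsymptoticallyAlmostSurely p (λ n → pq≤eq≤? {n} (k n))
  locates-aas k rounding ε (δ , 0<δ , Nε , δ≤ε) = assemble (calibration p 0<p p<1)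
    (⅘^-small (ι 36) (ℚ.½ ℚ.* δ) (ℚₚ.positive⁻¹ (ι 36)) 0<½δ)
    where
    0<½δ : 0ℚ ℚ.< ℚ.½ ℚ.* δ
    0<½δ = *-pos ½>0 0<δ
    assemble : (∃₂ λ d t → Eventually (Calibrated p 0<p p<1 d t)) →
               (∃ λ J₀ → ∀ J → J₀ ℕ.≤ J → ι 36 ℚ.* ⅘ ^ J ℚ.≤ ℚ.½ ℚ.* δ) →
               Eventually λ n → ∣ Pr p n (pq≤eq≤? (k n)) - 1ℝ ∣ < ε
    assemble (d , t , M₀ , calibrated) (J₀ , small) =
      2 ℕ.^ (J₀ ℕ.⊔ 4 ℕ.* (t ℕ.* (d ℕ.+ 3))) , λ n large →
      -- Half of δ bounds the deviation; the other half is the positive gap that `<` on `ℝ` demands.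
      ℚ.½ ℚ.* δ , 0<½δ , M₀ ℕ.⊔ Nε , λ m M≤m → ℚₚ.≤-trans
        (ℚₚ.+-monoˡ-≤ (ℚ.½ ℚ.* δ) (converges k rounding calibrated small n large m (⊔-l {M₀} M≤m)))
        (ℚₚ.≤-trans (ℚₚ.≤-reflexive (trans (half+half δ) (sym (ℚₚ.+-identityˡ δ))))
          (δ≤ε m (⊔-r {M₀} M≤m)))

theorem3p7 : (p : ℝ) (0<p : 0ℝ < p) (p<1 : p < 1ℝ) →
    (∀ (k : ℕ → ℕ) → (∀ n → k n IsRoundingOf bound p 0<p p<1 n) →
    AsymptoticallyAlmostSurely p (λ n → pq≤eq≤? {n} (k n)))
    × bound p 0<p p<1 ∈O log
theorem3p7 p 0<p p<1 = locates-aas p 0<p p<1 , bound∈O p 0<p p<1
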